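{- Let $k\ge 1$, let $\mathcal{M}_1,\dots,\mathcal{M}_k$ be arbitrary matroids on a common ground set $V$ with $|V|=n$, with families of independent sets $\mathcal{I}_1,\dots,\mathcal{I}_k$, and let $f:2^V\to\mathbb{R}_{\ge 0}$ be a non-negative submodular function. Let $\epsilon>0$ be such that $1/\epsilon$ is at most polynomial in $n$. Then Algorithm A (described in the context) with parameter $\epsilon$ runs in time $n^{O(k)}$ and returns a set $S\in\bigcap_{j=1}^k\mathcal{I}_j$ with $$f(S)\ \ge\ \frac{1}{(1+\epsilon)\left(k+2+\frac1k\right)}\cdot\max\Big\{f(T)\ :\ T\in\bigcap_{j=1}^k\mathcal{I}_j\Big\}.$$ That is, Algorithm A is a $\left(\frac{1}{(1+\epsilon)(k+2+\frac1k)}\right)$-approximation algorithm for maximizing a non-negative submodular function subject to any $k$ matroid constraints.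
   Context: A function $f:2^V\to\mathbb{R}$ is submodular if $f(S\cup T)+f(S\cap T)\le f(S)+f(T)$ for all $S,T\subseteq V$ (it need not be monotone). The function $f$ is accessed through a value oracle (given $S$, returns $f(S)$) and each matroid through an independence oracle; oracle calls count as unit-time steps. The symbol $\phi$ denotes "no element", so $S\setminus\{\phi\}=S$. Approximate Local Search Procedure B, on input a set $X\subseteq V$: Start with $S=\{v\}$, where $v\in X$ has maximum value $f(\{v\})$ among elements of $X$ with $\{v\}\in\bigcap_j\mathcal{I}_j$ (start with $S=\emptyset$ if there is no such $v$). While one of the following operations is available, perform it: - Delete operation: if $e\in S$ is such that $f(S\setminus\{e\})\ge(1+\frac{\epsilon}{n^4})f(S)$, then replace $S$ by $S\setminus\{e\}$. - Exchange operation: if $d\in X\setminus S$ and $e_1,\dots,e_k\in S\cup\{\phi\}$ are such that $(S\setminus\{e_i\})\cup\{d\}\in\mathcal{I}_i$ for all $i\in\{1,\dots,k\}$ and $f((S\setminus\{e_1,\dots,e_k\})\cup\{d\})>(1+\frac{\epsilon}{n^4})f(S)$, then replace $S$ by $(S\setminus\{e_1,\dots,e_k\})\cup\{d\}$. Return the final $S$. Algorithm A: Set $V_1=V$. For $i=1,\dots,k+1$: apply Procedure B to $X=V_i$ to obtain $S_i\subseteq V_i$, and set $V_{i+1}=V_i\setminus S_i$. Return a set of maximum $f$-value among $S_1,\dots,S_{k+1}$. -}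

module Defs where

open import Level using (Level; 0ℓ; _⊔_) renaming (suc to lsuc)
open import Algebra.Bundles using (CommutativeRing)
open import Data.Bool.Base using (Bool; true; false)
open import Data.Fin.Base using (Fin)
open import Data.Fin.Properties using (all?)
open import Data.Fin.Subset using (Subset; _∈_; _∉_; _⊆_; ⊥; ⊤; ⁅_⁆; _∪_; _∩_; _─_; _-_; ⋃; ∣_∣)
open import Data.Fin.Subset.Properties using (_∈?_)
open import Data.List.Base as List using (List; []; _∷_; _++_; cartesianProductWith)
open import Data.List.Relation.Binary.Permutation.Propositional using (_↭_)
open import Data.Maybe.Base using (Maybe; just; nothing; maybe)
open import Data.Maybe.Relation.Unary.All using () renaming (dec to allMaybe?)
open import Data.Nat.Base as ℕ using (ℕ; zero; suc)
open import Data.Product.Base using (Σ; ∃; _×_; _,_; proj₁; proj₂)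
open import Data.Vec.Base as Vec using (Vec; []; _∷_)
open import Data.Vec.Relation.Unary.All using () renaming (all? to allVec?)
open import Relation.Binary.Bundles using (TotalOrder)
open import Relation.Binary.Core using (Rel)
open import Relation.Binary.PropositionalEquality.Core using (_≡_)
open import Relation.Binary.Structures using (IsDecTotalOrder)
open import Relation.Nullary.Decidable.Core using (Dec; yes; no)
open import Relation.Nullary.Negation.Core using (¬_)
open import Relation.Unary using (Pred; Decidable)
import Algebra.Definitions.RawMonoid as RawMonoidDefinitions
import Data.List.Extrema as Extrema
import Relation.Binary.Construct.NonStrictToStrict as ToStrict

-- Linearly ordered fields, the setting in which the real numbers are used.
-- The order is decidable because the algorithm compares values of f in unit
-- time. Inversion is total, but nothing is assumed about the inverse of 0.

record OrderedField c ℓ₁ ℓ₂ : Set (lsuc (c ⊔ ℓ₁ ⊔ ℓ₂)) where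
  infix  4 _≤_
  infix  8 _⁻¹
  field
    commutativeRing : CommutativeRing c ℓ₁

  open CommutativeRing commutativeRing public

  field
    _≤_             : Rel Carrier ℓ₂
    isDecTotalOrder : IsDecTotalOrder _≈_ _≤_
    +-monoʳ-≤       : ∀ x {y z} → y ≤ z → x + y ≤ x + z
    *-nonNegative   : ∀ {x y} → 0# ≤ x → 0# ≤ y → 0# ≤ x * y
    0≉1             : ¬ (0# ≈ 1#)
    _⁻¹             : Carrier → Carrier
    *-inverseʳ      : ∀ {x} → ¬ (x ≈ 0#) → x * x ⁻¹ ≈ 1#

  open IsDecTotalOrder isDecTotalOrder public
    using (_≟_; _≤?_; isTotalOrder)

  open ToStrict _≈_ _≤_ public using (_<_)

  _<?_ : ∀ x y → Dec (x < y)
  _<?_ = ToStrict.<-decidable _≈_ _≤_ _≟_ _≤?_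

  totalOrder : TotalOrder c ℓ₁ ℓ₂
  totalOrder = record { isTotalOrder = isTotalOrder }

  fromℕ : ℕ → Carrier
  fromℕ m = m · 1#
    where open RawMonoidDefinitions +-rawMonoid using () renaming (_×_ to _·_)

record Matroid (n : ℕ) : Set₁ where
  field
    Indep      : Pred (Subset n) 0ℓ
    indep?     : Decidable Indep
    ∅-indep    : Indep ⊥
    hereditary : ∀ {S T} → S ⊆ T → Indep T → Indep S
    augment    : ∀ {S T} → Indep S → Indep T → ∣ S ∣ ℕ.< ∣ T ∣ →
                 ∃ λ x → x ∈ T × x ∉ S × Indep (S ∪ ⁅ x ⁆)

open Matroid using (Indep; indep?)

module _ {n k : ℕ} (M : Fin k → Matroid n) where

  Common : Subset n → Set
  Common S = ∀ j → Indep (M j) S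

  common? : Decidable Common
  common? S = all? λ j → indep? (M j) S

tuples : ∀ {a} {A : Set a} m → List A → List (Vec A m)
tuples zero    xs = [] ∷ []
tuples (suc m) xs = cartesianProductWith _∷_ xs (tuples m xs)

module _ {c ℓ₁ ℓ₂} (F : OrderedField c ℓ₁ ℓ₂) where
  open OrderedField F

  NonNegative : ∀ {n} → (Subset n → Carrier) → Set ℓ₂
  NonNegative f = ∀ S → 0# ≤ f S

  Submodular : ∀ {n} → (Subset n → Carrier) → Set ℓ₂
  Submodular f = ∀ S T → f (S ∪ T) + f (S ∩ T) ≤ f S + f T

  -- max { f T : T common independent }. The seed f ∅ of the maximum is one of
  -- the values of f being compared, since ∅ is independent in every matroid.
  optimum : ∀ {n k} → (Fin k → Matroid n) → (Subset n → Carrier) → Carrier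
  optimum {n} M f =
    max (f ⊥) (List.map f (List.filter (common? M) (tuples n (true ∷ false ∷ []))))
    where open Extrema totalOrder using (max)

------------------------------------------------------------------------
-- Step counting

-- A loop-free computation: its result and the number of unit-time steps used.
record Timed {a} (A : Set a) : Set a where
  constructor _after_
  field
    result : A
    time   : ℕ

open Timed public

infixl 1 _>>=_

return : ∀ {a} {A : Set a} → A → Timed A
return x = x after 0

_>>=_ : ∀ {a b} {A : Set a} {B : Set b} → Timed A → (A → Timed B) → Timed B
(x after t) >>= g = result (g x) after (t ℕ.+ time (g x))

costing : ∀ {a} {A : Set a} → ℕ → A → Timed A
costing t x = x after t

-- While body s s′ t: starting from state s, repeating the body until it
-- answers `nothing` takes t steps in total and stops in state s′.
data While {a} {A : Set a} (body : A → Timed (Maybe A)) : A → A → ℕ → Set a where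
  stop : ∀ {s t} → body s ≡ nothing after t → While body s s t
  step : ∀ {s s′ s″ t u} → body s ≡ just s′ after t → While body s′ s″ u →
         While body s s″ (t ℕ.+ u)

------------------------------------------------------------------------
-- The algorithm

-- `nothing` in the vector of an exchange is the dummy element φ.
data Move (n k : ℕ) : Set where
  delete   : Fin n → Move n k
  exchange : Fin n → Vec (Maybe (Fin n)) k → Move n k

allMoves : ∀ n k → List (Move n k)
allMoves n k =
  List.map delete (List.allFin n) ++
  cartesianProductWith exchange (List.allFin n)
    (tuples k (nothing ∷ List.map just (List.allFin n)))

-- The description of the algorithm does not say which maximiser or which
-- available operation is used. A value of Choices fixes the order in which
-- candidates are examined, the first suitable one being taken; since the orders
-- are arbitrary, every admissible behaviour arises. The order of the moves may
-- depend on the round (the number of rounds still to come) and on the current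
-- set, and a set never recurs within a round.
record Choices (n k : ℕ) : Set where
  field
    elements : (r : ℕ) → ∃ λ vs → vs ↭ List.allFin n
    moves    : (r : ℕ) (S : Subset n) → ∃ λ ms → ms ↭ allMoves n k
    outputs  : (Ss : List (Subset n)) → ∃ λ Ts → Ts ↭ Ss

-- Every oracle call, field operation, comparison and membership test is one
-- step; writing down a subset of the ground set is n steps.

module Algorithm {c ℓ₁ ℓ₂} (F : OrderedField c ℓ₁ ℓ₂) {n k : ℕ}
                 (M : Fin k → Matroid n) (f : Subset n → OrderedField.Carrier F)
                 (ε : OrderedField.Carrier F) (choices : Choices n k) where
  open OrderedField F using (Carrier; _≤_; _≤?_; _<?_; _+_; _*_; _⁻¹; 1#; fromℕ)
  open Choices choices

  value : Subset n → Timed Carrier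
  value S = costing 1 (f S)

  independent : ∀ j S → Timed (Dec (Indep (M j) S))
  independent j S = costing 1 (indep? (M j) S)

  -- Whether T j is independent in the matroid M j for every j in the list.
  allIndependent : (Fin k → Subset n) → List (Fin k) → Timed Bool
  allIndependent T []       = return true
  allIndependent T (j ∷ js) = do
    Tⱼ ← costing n (T j)
    yes _ ← independent j Tⱼ
      where no _ → return false
    allIndependent T js

  -- (1 + ε/n⁴) f(S). The n steps pay for the image of n in the field; for n = 0
  -- the division is meaningless, but then there is no move to be tested.
  threshold : Subset n → Timed Carrier
  threshold S = do
    v ← value S
    costing (n ℕ.+ 7) ((1# + ε * fromℕ (n ℕ.^ 4) ⁻¹) * v)

  elem : Maybe (Fin n) → Subset n
  elem = maybe ⁅_⁆ ⊥

  attempt : Subset n → Subset n → Move n k → Timed (Maybe (Subset n))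
  attempt X S (delete e) = do
    yes _ ← costing 1 (e ∈? S)
      where no _ → return nothing
    S′ ← costing n (S - e)
    v′ ← value S′
    b  ← threshold S
    yes _ ← costing 1 (b ≤? v′)
      where no _ → return nothing
    return (just S′)
  attempt X S (exchange d es) = do
    yes _ ← costing 1 (d ∈? X)
      where no _ → return nothing
    no _ ← costing 1 (d ∈? S)
      where yes _ → return nothing
    yes _ ← costing k (allVec? (allMaybe? (_∈? S)) es)
      where no _ → return nothing
    true ← allIndependent (λ i → (S ─ elem (Vec.lookup es i)) ∪ ⁅ d ⁆) (List.allFin k)
      where false → return nothing
    S′ ← costing (k ℕ.* n ℕ.+ n) ((S ─ ⋃ (List.map elem (Vec.toList es))) ∪ ⁅ d ⁆)
    v′ ← value S′
    b  ← threshold S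
    yes _ ← costing 1 (b <? v′)
      where no _ → return nothing
    return (just S′)

  -- suc k steps are charged for reading off each move.
  search : Subset n → Subset n → List (Move n k) → Timed (Maybe (Subset n))
  search X S []       = return nothing
  search X S (m ∷ ms) = do
    m′ ← costing (suc k) m
    nothing ← attempt X S m′
      where just S′ → return (just S′)
    search X S ms

  feasibleSingletons : Subset n → List (Fin n) → Timed (List (Subset n))
  feasibleSingletons X []       = return []
  feasibleSingletons X (v ∷ vs) = do
    Ss ← feasibleSingletons X vs
    yes _ ← costing 1 (v ∈? X)
      where no _ → return Ss
    true ← allIndependent (λ _ → ⁅ v ⁆) (List.allFin k)
      where false → return Ss
    costing n (⁅ v ⁆ ∷ Ss)

  better : Subset n → List (Subset n) → Timed (Subset n)
  better S []       = return S
  better S (T ∷ Ts) = do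
    v ← value S
    w ← value T
    yes _ ← costing 1 (v <? w)
      where no _ → better S Ts
    better T Ts

  -- A set of maximum value in the list, or ∅ if the list is empty.
  best : List (Subset n) → Timed (Subset n)
  best []       = return ⊥
  best (S ∷ Ss) = better S Ss

  start : ℕ → Subset n → Timed (Subset n)
  start r X = do
    Ss ← feasibleSingletons X (proj₁ (elements r))
    best Ss

  improve : ℕ → Subset n → Subset n → Timed (Maybe (Subset n))
  improve r X S = search X S (proj₁ (moves r S))

  -- ProcedureB r X S t: on input X, in the round with r rounds still to come,
  -- the local search returns S after t steps.
  ProcedureB : ℕ → Subset n → Subset n → ℕ → Set
  ProcedureB r X S t =
    ∃ λ u → While (improve r X) (result (start r X)) S u × t ≡ time (start r X) ℕ.+ u

  -- Rounds r X Ss t: r successive rounds beginning with the set X produce the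
  -- sets Ss in t steps.
  data Rounds : ℕ → Subset n → List (Subset n) → ℕ → Set where
    []  : ∀ {X} → Rounds 0 X [] 0
    _∷_ : ∀ {r X S Ss t u} → ProcedureB r X S t → Rounds r (X ─ S) Ss u →
          Rounds (suc r) X (S ∷ Ss) (t ℕ.+ (n ℕ.+ u))

  -- AlgorithmA S t: the algorithm halts after t steps and returns S.
  AlgorithmA : Subset n → ℕ → Set
  AlgorithmA S t =
    ∃ λ Ss → ∃ λ u → Rounds (suc k) ⊤ Ss u ×
      (let output = best (proj₁ (outputs Ss)) in
       S ≡ result output × t ≡ u ℕ.+ time output)

open Algorithm public using (AlgorithmA)

{-# OPTIONS --safe #-}

-- Let S be approximately locally optimal in X and C ⊆ X common independent. In
-- each matroid the elements of C ─ S can be exchanged against distinct elements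
-- of S ─ C. As no exchange is available, submodularity gives, summing over C ─ S,
--   f(S ∪ C) − f(S) ≤ Σ_d (f(S) − f(S ─ A_d)) + error,
-- where each element of S ─ C lies in at most k of the sets A_d ⊆ S ─ C. Up to the
-- error allowed by the unavailable deletions, the marginal values of the elements
-- of S ─ C are non-negative, and they add up to f(S) − f(S ∩ C); hence
--   f(S ∪ C) + k f(S ∩ C) ≤ (1 + ε)(k + 1) f(S).
-- In round i this is applied to C = T ∩ Vᵢ. The sets Sᵢ being disjoint, one more
-- use of submodularity turns the sum over the k + 1 rounds into
--   k f(T) ≤ (1 + ε)(k + 1) Σᵢ f(Sᵢ) ≤ (1 + ε)(k + 1)² maxᵢ f(Sᵢ).

module Submission where

open import Data.Bool.Base using (Bool; true; false; if_then_else_; _∨_; _∧_)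
import Data.Bool.Properties as Bool
open import Data.Fin.Base using (Fin; zero; suc)
import Data.Fin.Properties as Fin
open import Data.Fin.Subset using (Subset; inside; outside; _∈_; _∉_; _⊆_; _⊂_; ⊥; ⊤; ⁅_⁆; _∪_; _∩_; _─_; _-_; ⋃; ∣_∣)
open import Data.Fin.Subset.Properties
open import Data.List.Base as List using (List; []; _∷_; length; cartesianProductWith)
import Data.List.Extrema as Extrema
open import Data.List.Membership.Propositional using () renaming (_∈_ to _∈ˡ_)
open import Data.List.Membership.Propositional.Properties using (∈-allFin; ∈-map⁺; ∈-++⁺ˡ; ∈-++⁺ʳ; ∈-cartesianProductWith⁺)
open import Data.List.Properties using (length-++; length-map; length-tabulate)
open import Data.List.Relation.Binary.Permutation.Propositional using (↭-sym)
open import Data.List.Relation.Binary.Permutation.Propositional.Properties using (↭-length; ∈-resp-↭; All-resp-↭)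
open import Data.List.Relation.Unary.All as All using (All; []; _∷_)
import Data.List.Relation.Unary.All.Properties as All
open import Data.List.Relation.Unary.Any using (here; there)
open import Data.Maybe.Base using (Maybe; just; nothing; maybe)
open import Data.Maybe.Relation.Unary.All using (just; nothing) renaming (All to AllMaybe; dec to allMaybe?)
open import Data.Nat.Base as ℕ using (ℕ; zero; suc; z≤n; s≤s)
import Data.Nat.Properties as ℕ
open import Data.Product using (∃; ∃-syntax; _×_; _,_; proj₁; proj₂)
open import Data.Sum.Base using (_⊎_; inj₁; inj₂; [_,_]′)
open import Data.Vec.Base as Vec using (Vec; []; _∷_; lookup; tabulate)
open import Data.Vec.Properties using ([]=⇒lookup; lookup⇒[]=; lookup∘tabulate)
open import Data.Vec.Relation.Unary.All using () renaming (All to AllVec; all? to allVec?)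
import Data.Vec.Relation.Unary.All.Properties as AllVec
open import Defs
open import Function.Base using (_∘_; id)
open import Level using (0ℓ; _⊔_)
open import Relation.Binary.Bundles using (TotalOrder)
open import Relation.Binary.PropositionalEquality as ≡ using (_≡_; _≢_)
open import Relation.Nullary using (¬_; yes; no; contradiction; does; Reflects; ofʸ; ofⁿ)
open import Relation.Nullary.Decidable using (dec-true)
open import Relation.Unary using (Pred; Decidable)
import Algebra.Properties.CommutativeMonoid.Sum as CommutativeMonoidSum
import Algebra.Properties.Semiring.Mult as SemiringMult
import Algebra.Solver.Ring.NaturalCoefficients.Default as RingSolver
import Relation.Binary.Reasoning.PartialOrder as PartialOrderReasoning

-- As `f` need not be monotone, f(S ∪ C) may lie far below f(C), so a single local optimum does not
-- bound f(C). The later rounds repair this: the Sᵢ being disjoint, submodularity trades the terms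
-- f(Sᵢ ∪ Cᵢ) for copies of f(T ∩ Vᵢ), one for each round after the first. These k copies concern
-- shrinking parts of T; what T loses to S in a round is repaid by the term k f(S ∩ C). Hence k + 1
-- rounds. The ratio is $(k+1)^2/k = k+2+1/k$: one factor k + 1 comes from local optimality, the
-- other from replacing a sum over the rounds by a maximum, and the divisor from the k copies of
-- f(T).
--
-- The exchange has to be injective in each matroid separately, and S and C may differ in size; so a
-- symmetric exchange property is proved for arbitrary independent sets, not only for bases, and
-- then iterated.
--
-- Termination needs a separate growth argument, in which a start of value 0 is the exceptional
-- case. The exponent O(k) of the running time comes from searching all $n + n(n+1)^k$ moves.

private
  variable
    n k : ℕ

-- Ordered fields

module OrderedFieldProperties {c ℓ₁ ℓ₂} (F : OrderedField c ℓ₁ ℓ₂) where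
  open OrderedField F hiding (zero)
  open TotalOrder totalOrder public using (total; poset)
    renaming (refl to ≤-refl; reflexive to ≤-reflexive; trans to ≤-trans; antisym to ≤-antisym)
  open CommutativeMonoidSum +-commutativeMonoid public
    using (sum; sum-syntax; ∑-distrib-+; ∑-comm; sum-replicate)
  open SemiringMult semiring public using (×1-homo-*; ×-assoc-*; ×-congʳ)
  open RingSolver commutativeSemiring public using (solve; con; _:=_; _:+_; _:*_)
  module ≤-Reasoning = PartialOrderReasoning poset
  open ≤-Reasoning

  ≤∧≮⇒≈ : ∀ {x y} → x ≤ y → ¬ x < y → x ≈ y
  ≤∧≮⇒≈ {x} {y} x≤y x≮y with x ≟ y
  ... | yes x≈y = x≈y
  ... | no  x≉y = contradiction (x≤y , x≉y) x≮y

  ≰⇒≥ : ∀ {x y} → ¬ x ≤ y → y ≤ x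
  ≰⇒≥ {x} {y} x≰y with total x y
  ... | inj₁ x≤y = contradiction x≤y x≰y
  ... | inj₂ y≤x = y≤x

  ≮⇒≥ : ∀ {x y} → ¬ x < y → y ≤ x
  ≮⇒≥ {x} {y} x≮y with total x y
  ... | inj₁ x≤y = ≤-reflexive (sym (≤∧≮⇒≈ x≤y x≮y))
  ... | inj₂ y≤x = y≤x

  <⇒≱ : ∀ {x y} → x < y → ¬ y ≤ x
  <⇒≱ (x≤y , x≉y) y≤x = x≉y (≤-antisym x≤y y≤x)

  <-≤-trans : ∀ {x y z} → x < y → y ≤ z → x < z
  <-≤-trans (x≤y , x≉y) y≤z = ≤-trans x≤y y≤z ,
    λ x≈z → x≉y (≤-antisym x≤y (≤-trans y≤z (≤-reflexive (sym x≈z))))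

  +-monoˡ-≤ : ∀ z {x y} → x ≤ y → x + z ≤ y + z
  +-monoˡ-≤ z {x} {y} x≤y = begin
    x + z  ≈⟨ +-comm x z ⟩
    z + x  ≤⟨ +-monoʳ-≤ z x≤y ⟩
    z + y  ≈⟨ +-comm z y ⟩
    y + z  ∎

  +-mono-≤ : ∀ {x y u v} → x ≤ y → u ≤ v → x + u ≤ y + v
  +-mono-≤ {x} {y} {u} {v} x≤y u≤v = ≤-trans (+-monoˡ-≤ u x≤y) (+-monoʳ-≤ y u≤v)

  +-cancelʳ-≤ : ∀ z {x y} → x + z ≤ y + z → x ≤ y
  +-cancelʳ-≤ z {x} {y} x+z≤y+z = begin
    x              ≈⟨ cancel x ⟨
    x + z + - z    ≤⟨ +-monoˡ-≤ (- z) x+z≤y+z ⟩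
    y + z + - z    ≈⟨ cancel y ⟩
    y              ∎
    where
    cancel : ∀ x → x + z + - z ≈ x
    cancel x = trans (+-assoc x z (- z)) (trans (+-congˡ (-‿inverseʳ z)) (+-identityʳ x))

  x≤x+y : ∀ {x y} → 0# ≤ y → x ≤ x + y
  x≤x+y {x} {y} 0≤y = begin
    x       ≈⟨ +-identityʳ x ⟨
    x + 0#  ≤⟨ +-monoʳ-≤ x 0≤y ⟩
    x + y   ∎

  +-nonNegative : ∀ {x y} → 0# ≤ x → 0# ≤ y → 0# ≤ x + y
  +-nonNegative 0≤x 0≤y = ≤-trans 0≤x (x≤x+y 0≤y)

  x≤y⇒0≤y-x : ∀ {x y} → x ≤ y → 0# ≤ y + - x
  x≤y⇒0≤y-x {x} {y} x≤y = begin
    0#       ≈⟨ -‿inverseʳ x ⟨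
    x + - x  ≤⟨ +-monoˡ-≤ (- x) x≤y ⟩
    y + - x  ∎

  x+[y-x]≈y : ∀ x y → y + - x + x ≈ y
  x+[y-x]≈y x y = trans (+-assoc y (- x) x) (trans (+-congˡ (-‿inverseˡ x)) (+-identityʳ y))

  *-monoʳ-≤ : ∀ {z} → 0# ≤ z → ∀ {x y} → x ≤ y → z * x ≤ z * y
  *-monoʳ-≤ {z} 0≤z {x} {y} x≤y = begin
    z * x                      ≤⟨ x≤x+y (*-nonNegative 0≤z (x≤y⇒0≤y-x x≤y)) ⟩
    z * x + z * (y + - x)      ≈⟨ distribˡ z x (y + - x) ⟨
    z * (x + (y + - x))        ≈⟨ *-congˡ (trans (+-comm x _) (x+[y-x]≈y x y)) ⟩
    z * y                      ∎

  *-monoˡ-≤ : ∀ {z} → 0# ≤ z → ∀ {x y} → x ≤ y → x * z ≤ y * z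
  *-monoˡ-≤ {z} 0≤z {x} {y} x≤y = begin
    x * z  ≈⟨ *-comm x z ⟩
    z * x  ≤⟨ *-monoʳ-≤ 0≤z x≤y ⟩
    z * y  ≈⟨ *-comm z y ⟩
    y * z  ∎

  0≤1 : 0# ≤ 1#
  0≤1 with total 0# 1#
  ... | inj₁ 0≤1 = 0≤1
  -- In this case -1 is non-negative, and so is its square, which is 1.
  ... | inj₂ 1≤0 = begin
    0#                            ≤⟨ *-nonNegative 0≤-1 0≤-1 ⟩
    - 1# * - 1#                   ≈⟨ +-identityʳ _ ⟨
    - 1# * - 1# + 0#              ≈⟨ +-congˡ (-‿inverseˡ 1#) ⟨
    - 1# * - 1# + (- 1# + 1#)     ≈⟨ solve 2 (λ m o → m :* m :+ (m :+ o) := m :* m :+ m :* con 1 :+ o) refl (- 1#) 1# ⟩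
    - 1# * - 1# + - 1# * 1# + 1#  ≈⟨ +-congʳ (distribˡ (- 1#) (- 1#) 1#) ⟨
    - 1# * (- 1# + 1#) + 1#       ≈⟨ +-congʳ (*-congˡ (-‿inverseˡ 1#)) ⟩
    - 1# * 0# + 1#                ≈⟨ +-congʳ (zeroʳ (- 1#)) ⟩
    0# + 1#                       ≈⟨ +-identityˡ 1# ⟩
    1#                            ∎
    where
    0≤-1 : 0# ≤ - 1#
    0≤-1 = begin
      0#         ≤⟨ x≤y⇒0≤y-x 1≤0 ⟩
      0# + - 1#  ≈⟨ +-identityˡ (- 1#) ⟩
      - 1#       ∎

  0<1 : 0# < 1#
  0<1 = 0≤1 , 0≉1

  0<x⇒x≉0 : ∀ {x} → 0# < x → ¬ x ≈ 0#
  0<x⇒x≉0 (_ , 0≉x) x≈0 = 0≉x (sym x≈0)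

  0<x⇒0≤x⁻¹ : ∀ {x} → 0# < x → 0# ≤ x ⁻¹
  0<x⇒0≤x⁻¹ {x} 0<x@(0≤x , _) with total 0# (x ⁻¹)
  ... | inj₁ 0≤x⁻¹ = 0≤x⁻¹
  ... | inj₂ x⁻¹≤0 = contradiction (begin
    1#        ≈⟨ *-inverseʳ (0<x⇒x≉0 0<x) ⟨
    x * x ⁻¹  ≤⟨ *-monoʳ-≤ 0≤x x⁻¹≤0 ⟩
    x * 0#    ≈⟨ zeroʳ x ⟩
    0#        ∎) (<⇒≱ 0<1)

  x⁻¹*[x*y]≈y : ∀ {x} → 0# < x → ∀ y → x ⁻¹ * (x * y) ≈ y
  x⁻¹*[x*y]≈y {x} 0<x y = begin-equality
    x ⁻¹ * (x * y)  ≈⟨ solve 3 (λ i x y → i :* (x :* y) := (x :* i) :* y) refl (x ⁻¹) x y ⟩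
    x * x ⁻¹ * y    ≈⟨ *-congʳ (*-inverseʳ (0<x⇒x≉0 0<x)) ⟩
    1# * y          ≈⟨ *-identityˡ y ⟩
    y               ∎

  *-cancelˡ-≤ : ∀ {z} → 0# < z → ∀ {x y} → z * x ≤ z * y → x ≤ y
  *-cancelˡ-≤ {z} 0<z {x} {y} zx≤zy = begin
    x               ≈⟨ x⁻¹*[x*y]≈y 0<z x ⟨
    z ⁻¹ * (z * x)  ≤⟨ *-monoʳ-≤ (0<x⇒0≤x⁻¹ 0<z) zx≤zy ⟩
    z ⁻¹ * (z * y)  ≈⟨ x⁻¹*[x*y]≈y 0<z y ⟩
    y               ∎

  *-positive : ∀ {x y} → 0# < x → 0# < y → 0# < x * y
  *-positive {x} {y} 0<x@(0≤x , _) (0≤y , 0≉y) = *-nonNegative 0≤x 0≤y , λ 0≈xy →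
    0≉y (≤-antisym 0≤y (*-cancelˡ-≤ 0<x (≤-reflexive (trans (sym 0≈xy) (sym (zeroʳ x))))))

  x≤y*z⇒y⁻¹*x≤z : ∀ {x y z} → 0# < y → x ≤ y * z → y ⁻¹ * x ≤ z
  x≤y*z⇒y⁻¹*x≤z {x} {y} {z} 0<y x≤yz = begin
    y ⁻¹ * x        ≤⟨ *-monoʳ-≤ (0<x⇒0≤x⁻¹ 0<y) x≤yz ⟩
    y ⁻¹ * (y * z)  ≈⟨ x⁻¹*[x*y]≈y 0<y z ⟩
    z               ∎

  0≤fromℕ : ∀ m → 0# ≤ fromℕ m
  0≤fromℕ zero    = ≤-refl
  0≤fromℕ (suc m) = +-nonNegative 0≤1 (0≤fromℕ m)

  fromℕ-mono-≤ : ∀ m n → m ℕ.≤ n → fromℕ m ≤ fromℕ n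
  fromℕ-mono-≤ zero    n       _           = 0≤fromℕ n
  fromℕ-mono-≤ (suc m) (suc n) (s≤s m≤n) = +-monoʳ-≤ 1# (fromℕ-mono-≤ m n m≤n)

  0<fromℕ : ∀ m → 1 ℕ.≤ m → 0# < fromℕ m
  0<fromℕ m 1≤m = <-≤-trans 0<1 (begin
    1#       ≈⟨ +-identityʳ 1# ⟨
    fromℕ 1  ≤⟨ fromℕ-mono-≤ 1 m 1≤m ⟩
    fromℕ m  ∎)

  -- Brings the iteration bound, which is derived in the field, back to natural numbers.
  fromℕ-cancel-≤ : ∀ m n → fromℕ m ≤ fromℕ n → m ℕ.≤ n
  fromℕ-cancel-≤ zero    n       _   = z≤n
  fromℕ-cancel-≤ (suc m) zero    m≤0 = contradiction m≤0 (<⇒≱ (0<fromℕ (suc m) (s≤s z≤n)))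
  fromℕ-cancel-≤ (suc m) (suc n) m≤n = s≤s (fromℕ-cancel-≤ m n (+-cancelʳ-≤ 1# (begin
    fromℕ m + 1#  ≈⟨ +-comm _ 1# ⟩
    1# + fromℕ m  ≤⟨ m≤n ⟩
    1# + fromℕ n  ≈⟨ +-comm 1# _ ⟩
    fromℕ n + 1#  ∎)))

  sum-mono-≤ : ∀ {n} {g h : Fin n → Carrier} → (∀ i → g i ≤ h i) → sum g ≤ sum h
  sum-mono-≤ {zero}  g≤h = ≤-refl
  sum-mono-≤ {suc n} g≤h = +-mono-≤ (g≤h zero) (sum-mono-≤ (g≤h ∘ suc))

  sum-nonNegative : ∀ {n} {g : Fin n → Carrier} → (∀ i → 0# ≤ g i) → 0# ≤ sum g
  sum-nonNegative {zero}  0≤g = ≤-refl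
  sum-nonNegative {suc n} 0≤g = +-nonNegative (0≤g zero) (sum-nonNegative (0≤g ∘ suc))

  sum-const : ∀ n x → ∑[ i < n ] x ≈ fromℕ n * x
  sum-const n x = begin-equality
    ∑[ i < n ] x  ≈⟨ sum-replicate n ⟩
    n · x         ≈⟨ ×-congʳ n (*-identityˡ x) ⟨
    n · (1# * x)  ≈⟨ ×-assoc-* n 1# x ⟨
    fromℕ n * x   ∎
    where open SemiringMult semiring using () renaming (_×_ to _·_)

-- Polynomial bounds

-- The class $n^{O(k)}$, with one constant for all n and k. Powers of n never exceed 1 when n ≤ 1
-- and could not absorb constants there, hence the restriction to n ≥ 2.
PolynomiallyBounded : (ℕ → ℕ → ℕ) → Set
PolynomiallyBounded t = ∃ λ C → ∀ {n k} → 2 ℕ.≤ n → 1 ℕ.≤ k → t n k ℕ.≤ n ℕ.^ (C ℕ.* k)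

^-monoʳ-≤ : ∀ {n} → 2 ℕ.≤ n → ∀ {i j} → i ℕ.≤ j → n ℕ.^ i ℕ.≤ n ℕ.^ j
^-monoʳ-≤ {suc n} _ = ℕ.^-monoʳ-≤ (suc n)

m≤m*k : ∀ m {k} → 1 ℕ.≤ k → m ℕ.≤ m ℕ.* k
m≤m*k m {suc k} _ = ℕ.m≤m*n m (suc k)

m≤2^m : ∀ m → m ℕ.≤ 2 ℕ.^ m
m≤2^m zero    = z≤n
m≤2^m (suc m) = begin
  suc m                          ≤⟨ ℕ.+-mono-≤ (ℕ.m^n>0 2 m) (m≤2^m m) ⟩
  2 ℕ.^ m ℕ.+ 2 ℕ.^ m            ≡⟨ ≡.cong (2 ℕ.^ m ℕ.+_) (ℕ.+-identityʳ (2 ℕ.^ m)) ⟨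
  2 ℕ.^ suc m                    ∎
  where open ℕ.≤-Reasoning

m≤n^m : ∀ {n} → 2 ℕ.≤ n → ∀ m → m ℕ.≤ n ℕ.^ m
m≤n^m 2≤n m = ℕ.≤-trans (m≤2^m m) (ℕ.^-monoˡ-≤ m 2≤n)

constᵖ : ∀ m → PolynomiallyBounded λ _ _ → m
constᵖ m = m , λ 2≤n 1≤k → ℕ.≤-trans (m≤n^m 2≤n m) (^-monoʳ-≤ 2≤n (m≤m*k m 1≤k))

^ᵖ : ∀ b → PolynomiallyBounded λ n _ → n ℕ.^ b
^ᵖ b = b , λ 2≤n 1≤k → ^-monoʳ-≤ 2≤n (m≤m*k b 1≤k)

nᵖ : PolynomiallyBounded λ n _ → n
nᵖ = 1 , λ {n} 2≤n 1≤k → ℕ.≤-trans (ℕ.≤-reflexive (≡.sym (ℕ.^-identityʳ n))) (^-monoʳ-≤ 2≤n (m≤m*k 1 1≤k))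

kᵖ : PolynomiallyBounded λ _ k → k
kᵖ = 1 , λ {_} {k} 2≤n _ → ℕ.≤-trans (m≤n^m 2≤n k) (^-monoʳ-≤ 2≤n (ℕ.m≤n*m k 1))

-- The number of vectors (e₁, ..., e_k) over the ground set and φ. For n ≥ 2 the base 1 + n is at
-- most n².
[1+n]^kᵖ : PolynomiallyBounded λ n k → suc n ℕ.^ k
[1+n]^kᵖ = 2 , λ {n} {k} 2≤n _ → ℕ.≤-trans (ℕ.^-monoˡ-≤ k (1+n≤n² 2≤n)) (ℕ.≤-reflexive (ℕ.^-*-assoc n 2 k))
  where
  open ℕ.≤-Reasoning
  1+n≤n² : ∀ {n} → 2 ℕ.≤ n → suc n ℕ.≤ n ℕ.^ 2
  1+n≤n² {n} 2≤n = begin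
    1 ℕ.+ n        ≤⟨ ℕ.+-monoˡ-≤ n (ℕ.<⇒≤ 2≤n) ⟩
    n ℕ.+ n        ≡⟨ ≡.cong (n ℕ.+_) (ℕ.+-identityʳ n) ⟨
    2 ℕ.* n        ≤⟨ ℕ.*-monoˡ-≤ n 2≤n ⟩
    n ℕ.* n        ≡⟨ ≡.cong (n ℕ.*_) (ℕ.*-identityʳ n) ⟨
    n ℕ.^ 2        ∎

infixl 6 _+ᵖ_
infixl 7 _*ᵖ_

_*ᵖ_ : ∀ {s t} → PolynomiallyBounded s → PolynomiallyBounded t →
       PolynomiallyBounded λ n k → s n k ℕ.* t n k
_*ᵖ_ {s} {t} (c , s≤) (d , t≤) = c ℕ.+ d , λ {n} {k} 2≤n 1≤k → begin
  s n k ℕ.* t n k                        ≤⟨ ℕ.*-mono-≤ (s≤ 2≤n 1≤k) (t≤ 2≤n 1≤k) ⟩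
  n ℕ.^ (c ℕ.* k) ℕ.* n ℕ.^ (d ℕ.* k)    ≡⟨ ℕ.^-distribˡ-+-* n (c ℕ.* k) (d ℕ.* k) ⟨
  n ℕ.^ (c ℕ.* k ℕ.+ d ℕ.* k)            ≡⟨ ≡.cong (n ℕ.^_) (ℕ.*-distribʳ-+ k c d) ⟨
  n ℕ.^ ((c ℕ.+ d) ℕ.* k)                ∎
  where open ℕ.≤-Reasoning

-- With n ≥ 2, a sum of two terms is at most n times the product of their bounds.
_+ᵖ_ : ∀ {s t} → PolynomiallyBounded s → PolynomiallyBounded t →
       PolynomiallyBounded λ n k → s n k ℕ.+ t n k
_+ᵖ_ {s} {t} (c , s≤) (d , t≤) = suc (c ℕ.+ d) , λ {n} {k} 2≤n 1≤k →
  let N = n ℕ.^ ((c ℕ.+ d) ℕ.* k) in begin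
  s n k ℕ.+ t n k                     ≤⟨ ℕ.+-mono-≤ (s≤ 2≤n 1≤k) (t≤ 2≤n 1≤k) ⟩
  n ℕ.^ (c ℕ.* k) ℕ.+ n ℕ.^ (d ℕ.* k) ≤⟨ ℕ.+-mono-≤ (^-monoʳ-≤ 2≤n (ℕ.*-monoˡ-≤ k (ℕ.m≤m+n c d)))
                                                     (^-monoʳ-≤ 2≤n (ℕ.*-monoˡ-≤ k (ℕ.m≤n+m d c))) ⟩
  N ℕ.+ N                             ≡⟨ ≡.cong (N ℕ.+_) (ℕ.+-identityʳ N) ⟨
  2 ℕ.* N                             ≤⟨ ℕ.*-monoˡ-≤ N 2≤n ⟩
  n ℕ.* N                             ≤⟨ ℕ.*-monoˡ-≤ N (ℕ.≤-trans (ℕ.≤-reflexive (≡.sym (ℕ.^-identityʳ n))) (^-monoʳ-≤ 2≤n 1≤k)) ⟩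
  n ℕ.^ k ℕ.* N                       ≡⟨ ℕ.^-distribˡ-+-* n k ((c ℕ.+ d) ℕ.* k) ⟨
  n ℕ.^ (suc (c ℕ.+ d) ℕ.* k)         ∎
  where open ℕ.≤-Reasoning

-- Running time bounds

module Times (n k : ℕ) where

  -- The bracketing and the trailing zeros of the first two copy the sums that `_>>=_` builds along
  -- the longest path of `attempt`, so that the time bounds hold by computation and monotonicity.
  -- The first factor of `searchTime` is the number of moves.
  deleteTime exchangeTime moveTime searchTime startTime : ℕ
  deleteTime   = 1 ℕ.+ (n ℕ.+ (1 ℕ.+ ((1 ℕ.+ (n ℕ.+ 7)) ℕ.+ (1 ℕ.+ 0))))
  exchangeTime = 1 ℕ.+ (1 ℕ.+ (k ℕ.+ (k ℕ.* suc n ℕ.+ ((k ℕ.* n ℕ.+ n) ℕ.+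
                   (1 ℕ.+ ((1 ℕ.+ (n ℕ.+ 7)) ℕ.+ (1 ℕ.+ 0)))))))
  moveTime     = suc k ℕ.+ (deleteTime ℕ.+ exchangeTime)
  searchTime   = (n ℕ.+ n ℕ.* suc n ℕ.^ k) ℕ.* moveTime
  startTime    = n ℕ.* (1 ℕ.+ (k ℕ.* suc n ℕ.+ n)) ℕ.+ n ℕ.* 3

  -- Here `m` is an upper bound for 1/ε, so `maxIterations m` stands for n⁵/ε. In `procedureTime`,
  -- the inner `suc` makes the number of steps exceed that bound, `n` provides for the deletions
  -- after a start of value 0, and the outer `suc` pays for the last search, which finds no move.
  maxIterations procedureTime totalTime : ℕ → ℕ
  maxIterations m = n ℕ.* n ℕ.^ 4 ℕ.* m
  procedureTime m = startTime ℕ.+ suc (suc (maxIterations m) ℕ.+ n) ℕ.* searchTime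
  totalTime m     = suc k ℕ.* (procedureTime m ℕ.+ n) ℕ.+ suc k ℕ.* 3

-- The exponent is computed from the shape of `totalTime` alone, before n and k are given; this is
-- why the constant in the theorem depends only on `a` and `b`.
totalTimeᵖ : ∀ a b → PolynomiallyBounded λ n k → Times.totalTime n k (a ℕ.* n ℕ.^ b)
totalTimeᵖ a b = 1+ kᵖ *ᵖ (procedureᵖ +ᵖ nᵖ) +ᵖ 1+ kᵖ *ᵖ constᵖ 3
  where
  infix 8 1+_
  1+_ : ∀ {t} → PolynomiallyBounded t → PolynomiallyBounded λ n k → suc (t n k)
  1+_ = constᵖ 1 +ᵖ_
  testᵖ : PolynomiallyBounded λ n _ → 1 ℕ.+ ((1 ℕ.+ (n ℕ.+ 7)) ℕ.+ (1 ℕ.+ 0))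
  testᵖ = 1+ (1+ (nᵖ +ᵖ constᵖ 7) +ᵖ constᵖ 1)
  deleteᵖ : PolynomiallyBounded Times.deleteTime
  deleteᵖ = 1+ (nᵖ +ᵖ testᵖ)
  exchangeᵖ : PolynomiallyBounded Times.exchangeTime
  exchangeᵖ = 1+ (1+ (kᵖ +ᵖ (kᵖ *ᵖ 1+ nᵖ +ᵖ (kᵖ *ᵖ nᵖ +ᵖ nᵖ +ᵖ testᵖ))))
  searchᵖ : PolynomiallyBounded Times.searchTime
  searchᵖ = (nᵖ +ᵖ nᵖ *ᵖ [1+n]^kᵖ) *ᵖ (1+ kᵖ +ᵖ (deleteᵖ +ᵖ exchangeᵖ))
  startᵖ : PolynomiallyBounded Times.startTime
  startᵖ = nᵖ *ᵖ 1+ (kᵖ *ᵖ 1+ nᵖ +ᵖ nᵖ) +ᵖ nᵖ *ᵖ constᵖ 3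
  procedureᵖ : PolynomiallyBounded λ n k → Times.procedureTime n k (a ℕ.* n ℕ.^ b)
  procedureᵖ = startᵖ +ᵖ 1+ (1+ (nᵖ *ᵖ ^ᵖ 4 *ᵖ (constᵖ a *ᵖ ^ᵖ b)) +ᵖ nᵖ) *ᵖ searchᵖ

-- Submodular functions

x∈p─q⇒x∉q : ∀ {x : Fin n} {p q : Subset n} → x ∈ p ─ q → x ∉ q
x∈p─q⇒x∉q {p = _ ∷ _} {outside ∷ _} Vec.here ()
x∈p─q⇒x∉q {p = _ ∷ _} {_ ∷ _} (Vec.there x∈p─q) (Vec.there x∈q) = x∈p─q⇒x∉q x∈p─q x∈q

x∈p─q⁻ : ∀ {x : Fin n} (p q : Subset n) → x ∈ p ─ q → x ∈ p × x ∉ q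
x∈p─q⁻ p q x∈p─q = p─q⊆p p q x∈p─q , x∈p─q⇒x∉q x∈p─q

p⊆q⇒p∩q≡p : ∀ {p q : Subset n} → p ⊆ q → p ∩ q ≡ p
p⊆q⇒p∩q≡p {p = p} {q} p⊆q = ⊆-antisym (p∩q⊆p p q) (λ x∈p → x∈p∩q⁺ (x∈p , p⊆q x∈p))

p⊆q⇒p∪q≡q : ∀ {p q : Subset n} → p ⊆ q → p ∪ q ≡ q
p⊆q⇒p∪q≡q {p = p} {q} p⊆q =
  ⊆-antisym ([ p⊆q , (λ x∈q → x∈q) ]′ ∘ x∈p∪q⁻ p q) (q⊆p∪q p q)

-- Equal by computation to the function of the same name in `Algorithm`, but free of that module's
-- parameters, so that submodular functions and matroids can be treated without reference to the
-- algorithm.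
elem : Maybe (Fin n) → Subset n
elem = maybe ⁅_⁆ ⊥

elems : Vec (Maybe (Fin n)) k → Subset n
elems es = ⋃ (List.map elem (Vec.toList es))

x∈elem⁻ : ∀ {x : Fin n} m → x ∈ elem m → m ≡ just x
x∈elem⁻ (just y) x∈⁅y⁆ = ≡.cong just (≡.sym (x∈⁅y⁆⇒x≡y y x∈⁅y⁆))
x∈elem⁻ nothing  x∈⊥   = contradiction x∈⊥ ∉⊥

x∈elems⁻ : ∀ {x : Fin n} (es : Vec (Maybe (Fin n)) k) → x ∈ elems es →
           ∃ λ j → lookup es j ≡ just x
x∈elems⁻ [] x∈⊥ = contradiction x∈⊥ ∉⊥
x∈elems⁻ (e ∷ es) x∈ with x∈p∪q⁻ (elem e) (elems es) x∈
... | inj₁ x∈e  = zero , x∈elem⁻ e x∈e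
... | inj₂ x∈es with x∈elems⁻ es x∈es
... | j , eq = suc j , eq

elem⊆elems : ∀ (es : Vec (Maybe (Fin n)) k) j → elem (lookup es j) ⊆ elems es
elem⊆elems (e ∷ es) zero    = p⊆p∪q (elems es)
elem⊆elems (e ∷ es) (suc j) = q⊆p∪q (elem e) (elems es) ∘ elem⊆elems es j

module SubmodularProperties {c ℓ₁ ℓ₂} (F : OrderedField c ℓ₁ ℓ₂) where
  open OrderedField F hiding (zero; _-_)
  open OrderedFieldProperties F
  open ≤-Reasoning

  submodular-≡ : {f : Subset n → Carrier} → Submodular F f →
                 ∀ S T {U I} → S ∪ T ≡ U → S ∩ T ≡ I → f U + f I ≤ f S + f T
  submodular-≡ sub S T ≡.refl ≡.refl = sub S T

  -- Fixing the membership of the first element leaves a submodular function of the others. This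
  -- permits induction on the ground set instead of on chains of subsets.
  submodular-∷ : {f : Subset (suc n) → Carrier} → Submodular F f → ∀ s → Submodular F (f ∘ (s ∷_))
  submodular-∷ sub s S T = submodular-≡ sub (s ∷ S) (s ∷ T)
    (≡.cong (_∷ S ∪ T) (Bool.∨-idem s)) (≡.cong (_∷ S ∩ T) (Bool.∧-idem s))

  -- Diminishing returns: the gain of an element only shrinks while the other elements of `C` are
  -- added. The sum runs over the whole ground set, so `g` has to be non-negative where it bounds no
  -- gain.
  union-bound : (f : Subset n → Carrier) → Submodular F f → ∀ S C (g : Fin n → Carrier) →
                (∀ i → 0# ≤ g i) → (∀ i → i ∈ C → i ∉ S → f (S ∪ ⁅ i ⁆) ≤ f S + g i) →
                f (S ∪ C) ≤ f S + sum g
  union-bound f sub [] [] g 0≤g marginal = x≤x+y ≤-refl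
  union-bound f sub (s ∷ S) (c ∷ C) g 0≤g marginal = begin
    f ((s ∨ c) ∷ S ∪ C)                   ≤⟨ union-bound (f ∘ ((s ∨ c) ∷_)) (submodular-∷ sub (s ∨ c)) S C
                                             (g ∘ suc) (0≤g ∘ suc) tail ⟩
    f ((s ∨ c) ∷ S) + sum (g ∘ suc)       ≤⟨ +-monoˡ-≤ _ (head s c marginal) ⟩
    f (s ∷ S) + g zero + sum (g ∘ suc)  ≈⟨ +-assoc _ _ _ ⟩
    f (s ∷ S) + sum g                   ∎
    where
    head : ∀ s c → (∀ i → i ∈ c ∷ C → i ∉ s ∷ S → f ((s ∷ S) ∪ ⁅ i ⁆) ≤ f (s ∷ S) + g i) →
           f ((s ∨ c) ∷ S) ≤ f (s ∷ S) + g zero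
    head true  _     marginal = x≤x+y (0≤g zero)
    head false false marginal = x≤x+y (0≤g zero)
    head false true  marginal = ≡.subst (λ T → f (true ∷ T) ≤ f (false ∷ S) + g zero) (∪-identityʳ S)
      (marginal zero Vec.here λ ())
    -- The first element is already decided here; the gain of `i`, assumed over `s ∷ S`, is carried
    -- over to the possibly larger set by submodularity.
    tail : ∀ i → i ∈ C → i ∉ S → f ((s ∨ c) ∷ S ∪ ⁅ i ⁆) ≤ f ((s ∨ c) ∷ S) + g (suc i)
    tail i i∈C i∉S = +-cancelʳ-≤ (f (s ∷ S)) (begin
      f ((s ∨ c) ∷ S ∪ ⁅ i ⁆) + f (s ∷ S)        ≤⟨ submodular-≡ sub ((s ∨ c) ∷ S) (s ∷ S ∪ ⁅ i ⁆)
                                                    (≡.cong₂ _∷_ (∨-lemma s c) (p⊆q⇒p∪q≡q (p⊆p∪q ⁅ i ⁆)))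
                                                    (≡.cong₂ _∷_ (∧-lemma s c) (p⊆q⇒p∩q≡p (p⊆p∪q ⁅ i ⁆))) ⟩
      f ((s ∨ c) ∷ S) + f (s ∷ S ∪ ⁅ i ⁆)        ≤⟨ +-monoʳ-≤ _ hyp ⟩
      f ((s ∨ c) ∷ S) + (f (s ∷ S) + g (suc i))  ≈⟨ solve 3 (λ x y z → x :+ (y :+ z) := x :+ z :+ y) refl _ _ _ ⟩
      f ((s ∨ c) ∷ S) + g (suc i) + f (s ∷ S)    ∎)
      where
      ∨-lemma : ∀ s c → (s ∨ c) ∨ s ≡ s ∨ c
      ∨-lemma true  c = ≡.refl
      ∨-lemma false c = Bool.∨-identityʳ c
      ∧-lemma : ∀ s c → (s ∨ c) ∧ s ≡ s
      ∧-lemma true  c = ≡.refl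
      ∧-lemma false c = Bool.∧-zeroʳ c
      hyp : f (s ∷ S ∪ ⁅ i ⁆) ≤ f (s ∷ S) + g (suc i)
      hyp = ≡.subst (λ b → f (b ∷ S ∪ ⁅ i ⁆) ≤ f (s ∷ S) + g (suc i)) (Bool.∨-identityʳ s)
        (marginal (suc i) (Vec.there i∈C) (i∉S ∘ drop-there))

  -- The marginal values of the elements of S ─ P when they are added to P in
  -- increasing order of index.
  weight : (Subset n → Carrier) → (P S : Subset n) → Fin n → Carrier
  weight f (p ∷ P) (s ∷ S) zero    = f (s ∷ P) + - f (p ∷ P)
  weight f (p ∷ P) (s ∷ S) (suc i) = weight (f ∘ (s ∷_)) P S i

  -- The weights are the increments of `f` while the coordinates of `P` are replaced by those of `S`
  -- one at a time, so their sum telescopes.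
  sum-weight : ∀ (f : Subset n → Carrier) P S → sum (weight f P S) + f P ≈ f S
  sum-weight f []      []      = +-identityˡ _
  sum-weight f (p ∷ P) (s ∷ S) = begin-equality
    f (s ∷ P) + - f (p ∷ P) + tail + f (p ∷ P)    ≈⟨ solve 3 (λ x y z → x :+ y :+ z := y :+ (x :+ z)) refl _ tail _ ⟩
    tail + (f (s ∷ P) + - f (p ∷ P) + f (p ∷ P))  ≈⟨ +-congˡ (x+[y-x]≈y _ _) ⟩
    tail + f (s ∷ P)                              ≈⟨ sum-weight (f ∘ (s ∷_)) P S ⟩
    f (s ∷ S)                                     ∎
    where tail = sum (weight (f ∘ (s ∷_)) P S)

  weight-outside : ∀ (f : Subset n → Carrier) P S → P ⊆ S →
                   ∀ i → (i ∈ S → i ∈ P) → weight f P S i ≈ 0#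
  weight-outside f (p     ∷ P) (s     ∷ S) P⊆S (suc i) S⇒P =
    weight-outside (f ∘ (s ∷_)) P S (drop-∷-⊆ P⊆S) i (drop-there ∘ S⇒P ∘ Vec.there)
  weight-outside f (true  ∷ P) (true  ∷ S) P⊆S zero S⇒P = -‿inverseʳ _
  weight-outside f (false ∷ P) (false ∷ S) P⊆S zero S⇒P = -‿inverseʳ _
  weight-outside f (true  ∷ P) (false ∷ S) P⊆S zero S⇒P with () ← P⊆S Vec.here
  weight-outside f (false ∷ P) (true  ∷ S) P⊆S zero S⇒P with () ← S⇒P Vec.here

  marginal-≤ : {f : Subset (suc n) → Carrier} → Submodular F f → ∀ {P R} → P ⊆ R →
               f (inside ∷ R) ≤ f (outside ∷ R) + (f (inside ∷ P) + - f (outside ∷ P))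
  marginal-≤ {f = f} sub {P} {R} P⊆R = +-cancelʳ-≤ (f (outside ∷ P)) (begin
    f (inside ∷ R) + f (outside ∷ P)  ≤⟨ submodular-≡ sub (inside ∷ P) (outside ∷ R)
                                           (≡.cong (inside ∷_) (p⊆q⇒p∪q≡q P⊆R))
                                           (≡.cong (outside ∷_) (p⊆q⇒p∩q≡p P⊆R)) ⟩
    f (inside ∷ P) + f (outside ∷ R)  ≈⟨ +-comm _ _ ⟩
    f (outside ∷ R) + f (inside ∷ P)  ≈⟨ +-congˡ (x+[y-x]≈y _ _) ⟨
    f (outside ∷ R) + (f (inside ∷ P) + - f (outside ∷ P) + f (outside ∷ P))  ≈⟨ +-assoc _ _ _ ⟨
    f (outside ∷ R) + (f (inside ∷ P) + - f (outside ∷ P)) + f (outside ∷ P)  ∎)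

  weight-remove : (f : Subset n → Carrier) → Submodular F f → ∀ P S → P ⊆ S →
                  ∀ e → e ∈ S → e ∉ P → f S ≤ f (S - e) + weight f P S e
  weight-remove f sub (p ∷ P) (s ∷ S) P⊆S (suc e) (Vec.there e∈S) e∉P =
    weight-remove (f ∘ (s ∷_)) (submodular-∷ sub s) P S (drop-∷-⊆ P⊆S) e e∈S (e∉P ∘ Vec.there)
  weight-remove f sub (true  ∷ P) (s ∷ S) P⊆S zero _ e∉P = contradiction Vec.here e∉P
  weight-remove f sub (false ∷ P) (.true ∷ S) P⊆S zero Vec.here e∉P
    = ≡.subst (λ T → f (inside ∷ S) ≤ f (outside ∷ T) + _) (≡.sym (p─⊥≡p S)) (marginal-≤ sub (drop-∷-⊆ P⊆S))

  restrict : Subset n → (Fin n → Carrier) → Fin n → Carrier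
  restrict T w i = if lookup T i then w i else 0#

  restrict-≤ : {v w : Fin n → Carrier} → (∀ i → v i ≤ w i) → (∀ i → 0# ≤ w i) →
               ∀ {S T} → S ⊆ T → ∀ i → restrict S v i ≤ restrict T w i
  restrict-≤ v≤w 0≤w {S} {T} S⊆T i with lookup S i in eq | lookup T i in eq′
  ... | true  | true  = v≤w i
  ... | false | true  = 0≤w i
  ... | false | false = ≤-refl
  ... | true  | false with () ← ≡.trans (≡.sym eq′) ([]=⇒lookup (S⊆T (lookup⇒[]= i S eq)))

  -- If the elements of `S ─ R` are added to `R` in increasing order, the current set always
  -- contains the one over which the next weight was measured, so each gain is at most the
  -- corresponding weight.
  weight-bound : (f : Subset n → Carrier) → Submodular F f → ∀ P R S → P ⊆ R → R ⊆ S →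
                 f S ≤ f R + sum (restrict (S ─ R) (weight f P S))
  weight-bound f sub [] [] [] _ _ = x≤x+y ≤-refl
  weight-bound f sub (p ∷ P) (r ∷ R) (s ∷ S) P⊆R R⊆S = begin
    f (s ∷ S)                      ≤⟨ weight-bound (f ∘ (s ∷_)) (submodular-∷ sub s) P R S
                                        (drop-∷-⊆ P⊆R) (drop-∷-⊆ R⊆S) ⟩
    f (s ∷ R) + tail               ≤⟨ +-monoˡ-≤ tail (head p r s P⊆R R⊆S) ⟩
    f (r ∷ R) + new p r s + tail   ≈⟨ +-assoc _ _ _ ⟩
    f (r ∷ R) + (new p r s + tail) ∎
    where
    tail = sum (restrict (S ─ R) (weight (f ∘ (s ∷_)) P S))
    new : (p r s : Bool) → Carrier
    new p r s = restrict ((s ∷ S) ─ (r ∷ R)) (weight f (p ∷ P) (s ∷ S)) zero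
    head : ∀ p r s → p ∷ P ⊆ r ∷ R → r ∷ R ⊆ s ∷ S → f (s ∷ R) ≤ f (r ∷ R) + new p r s
    head p     true  true  P⊆R R⊆S = x≤x+y ≤-refl
    head p     false false P⊆R R⊆S = x≤x+y ≤-refl
    head p     true  false P⊆R R⊆S with () ← R⊆S Vec.here
    head true  false true  P⊆R R⊆S with () ← P⊆R Vec.here
    head false false true  P⊆R R⊆S = marginal-≤ sub (drop-∷-⊆ P⊆R)

  restrict-∪-≤ : {w : Fin n → Carrier} → (∀ i → 0# ≤ w i) →
                 ∀ S T i → restrict (S ∪ T) w i ≤ restrict S w i + restrict T w i
  restrict-∪-≤ 0≤w (true  ∷ S) (true  ∷ T) zero    = x≤x+y (0≤w zero)
  restrict-∪-≤ 0≤w (true  ∷ S) (false ∷ T) zero    = x≤x+y ≤-refl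
  restrict-∪-≤ 0≤w (false ∷ S) (_     ∷ T) zero    = ≤-reflexive (sym (+-identityˡ _))
  restrict-∪-≤ 0≤w (_     ∷ S) (_     ∷ T) (suc i) = restrict-∪-≤ (0≤w ∘ suc) S T i

  sum-restrict-⊥ : (w : Fin n → Carrier) → sum (restrict ⊥ w) ≈ 0#
  sum-restrict-⊥ {n = zero}  w = refl
  sum-restrict-⊥ {n = suc n} w = trans (+-identityˡ _) (sum-restrict-⊥ (w ∘ suc))

  -- Only an inequality, because an element may occur in several entries of `es`; the repetitions
  -- are harmless as the weights are non-negative.
  sum-restrict-elems : {w : Fin n → Carrier} → (∀ i → 0# ≤ w i) → (es : Vec (Maybe (Fin n)) k) →
                       sum (restrict (elems es) w) ≤ ∑[ j < k ] sum (restrict (elem (lookup es j)) w)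
  sum-restrict-elems {w = w} 0≤w []       = ≤-reflexive (sum-restrict-⊥ w)
  sum-restrict-elems {w = w} 0≤w (e ∷ es) = begin
    sum (restrict (elem e ∪ elems es) w)                          ≤⟨ sum-mono-≤ (restrict-∪-≤ 0≤w (elem e) (elems es)) ⟩
    sum (λ i → restrict (elem e) w i + restrict (elems es) w i)   ≈⟨ ∑-distrib-+ (restrict (elem e) w) (restrict (elems es) w) ⟩
    sum (restrict (elem e) w) + sum (restrict (elems es) w)       ≤⟨ +-monoʳ-≤ _ (sum-restrict-elems 0≤w es) ⟩
    _                                                             ∎

  sum-unique : ∀ {m x} → 0# ≤ x → (b : Fin m → Bool) → (∀ i j → b i ≡ true → b j ≡ true → i ≡ j) →
               sum (λ i → if b i then x else 0#) ≤ x
  sum-unique {zero}      0≤x b unique = 0≤x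
  sum-unique {suc m} {x} 0≤x b unique with b zero in eq
  ... | false = begin
    0# + sum (λ i → if b (suc i) then x else 0#)  ≈⟨ +-identityˡ _ ⟩
    sum (λ i → if b (suc i) then x else 0#)       ≤⟨ sum-unique 0≤x (b ∘ suc) (λ i j p q → Fin.suc-injective (unique (suc i) (suc j) p q)) ⟩
    x                                             ∎
  ... | true = begin
    x + sum (λ i → if b (suc i) then x else 0#)   ≤⟨ +-monoʳ-≤ x (sum-mono-≤ others) ⟩
    x + ∑[ i < m ] 0#                             ≈⟨ +-congˡ (trans (sum-const m 0#) (zeroʳ _)) ⟩
    x + 0#                                        ≈⟨ +-identityʳ x ⟩
    x                                             ∎
    where
    others : ∀ i → (if b (suc i) then x else 0#) ≤ 0#
    others i with b (suc i) in eq′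
    ... | false = ≤-refl
    ... | true with () ← unique zero (suc i) eq eq′

  -- Double counting: once the sums are swapped, each element is charged by at most one `d`.
  sum-restrict-injective : ∀ {m} {w : Fin n → Carrier} → (∀ i → 0# ≤ w i) → (π : Fin m → Maybe (Fin n)) →
                           (∀ {d d′ e} → π d ≡ just e → π d′ ≡ just e → d ≡ d′) →
                           ∑[ d < m ] sum (restrict (elem (π d)) w) ≤ sum w
  sum-restrict-injective {n = n} {m} {w} 0≤w π injective = begin
    sum (λ d → sum (λ e → restrict (elem (π d)) w e))  ≈⟨ ∑-comm (λ d e → restrict (elem (π d)) w e) ⟩
    sum (λ e → sum (λ d → restrict (elem (π d)) w e))  ≤⟨ sum-mono-≤ (λ e → sum-unique (0≤w e)
                                                            (λ d → lookup (elem (π d)) e) (λ d d′ p q →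
                                                              injective (at d e p) (at d′ e q))) ⟩
    sum w                                              ∎
    where
    at : ∀ d e → lookup (elem (π d)) e ≡ true → π d ≡ just e
    at d e p = x∈elem⁻ (π d) (lookup⇒[]= e _ p)

  -- The slack `δ * f S` is paid at most `n` times for the additions and `n` times in each of the
  -- `k` matroids, which gives it the same factor `k + 1` as `f S`. Its sign is assumed only in the
  -- presence of an element, because on an empty ground set `δ` will involve an unspecified inverse
  -- of 0.
  local-optimum-bound :
    (f : Subset n → Carrier) → Submodular F f → (δ : Carrier) (S C : Subset n) → (Fin n → 0# ≤ δ * f S) →
    (es : Fin n → Vec (Maybe (Fin n)) k) →
    (∀ {d d′ e} j → lookup (es d) j ≡ just e → lookup (es d′) j ≡ just e → d ≡ d′) →
    (∀ {d e} j → lookup (es d) j ≡ just e → e ∉ C) →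
    (∀ e → e ∈ S → f (S - e) ≤ (1# + δ) * f S) →
    (∀ d → d ∈ C → d ∉ S → f ((S ─ elems (es d)) ∪ ⁅ d ⁆) ≤ (1# + δ) * f S) →
    f (S ∪ C) + fromℕ k * f (S ∩ C) ≤ (fromℕ k + 1#) * (f S + fromℕ n * (δ * f S))
  local-optimum-bound {n = n} {k} f sub δ S C 0≤η es injective avoids delete-≤ exchange-≤ =
    begin
    f (S ∪ C) + κ * f P          ≤⟨ +-monoˡ-≤ _ (union-bound f sub S C g 0≤g add-≤) ⟩
    f S + sum g + κ * f P        ≤⟨ +-monoˡ-≤ _ (+-monoʳ-≤ _ sum-g) ⟩
    f S + (fromℕ n * η + κ * sum w′) + κ * f P
                                 ≈⟨ +-congʳ (+-congˡ (+-congˡ (*-congˡ (∑-distrib-+ w (λ _ → η))))) ⟩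
    f S + (fromℕ n * η + κ * (sum w + ∑[ i < n ] η)) + κ * f P
                                 ≈⟨ solve 6 (λ a b κ s t p → a :+ (b :+ κ :* (s :+ t)) :+ κ :* p :=
                                      a :+ b :+ κ :* (s :+ p :+ t)) refl (f S) _ κ (sum w) _ (f P) ⟩
    f S + fromℕ n * η + κ * (sum w + f P + ∑[ i < n ] η)
                                 ≈⟨ +-congˡ (*-congˡ (+-cong (sum-weight f P S) (sum-const n η))) ⟩
    f S + fromℕ n * η + κ * (f S + fromℕ n * η)
                                 ≈⟨ solve 2 (λ κ x → x :+ κ :* x := (κ :+ con 1) :* x) refl κ _ ⟩
    (κ + 1#) * (f S + fromℕ n * η) ∎
    where
    κ = fromℕ k
    η = δ * f S
    P = S ∩ C
    w = weight f P S
    -- The shift by η makes the weights non-negative, since no deletion is available.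
    w′ = λ e → w e + η

    expand : (1# + δ) * f S ≈ f S + η
    expand = solve 2 (λ d x → (con 1 :+ d) :* x := x :+ d :* x) refl δ (f S)

    0≤w′ : ∀ e → 0# ≤ w′ e
    0≤w′ e with e ∈? S | e ∈? P
    ... | yes e∈S | no e∉P = +-cancelʳ-≤ (f (S - e)) (begin
      0# + f (S - e)                ≈⟨ +-identityˡ _ ⟩
      f (S - e)                     ≤⟨ delete-≤ e e∈S ⟩
      (1# + δ) * f S                ≈⟨ expand ⟩
      f S + η                       ≤⟨ +-monoˡ-≤ _ (weight-remove f sub P S (p∩q⊆p S C) e e∈S e∉P) ⟩
      f (S - e) + w e + η           ≈⟨ solve 3 (λ x y z → x :+ y :+ z := y :+ z :+ x) refl _ _ _ ⟩
      w′ e + f (S - e)              ∎)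
    ... | yes e∈S | yes e∈P = outside-≤ (λ _ → e∈P)
      where
      outside-≤ : (e ∈ S → e ∈ P) → 0# ≤ w′ e
      outside-≤ h = ≤-trans (0≤η e) (≤-reflexive (sym (trans
        (+-congʳ (weight-outside f P S (p∩q⊆p S C) e h)) (+-identityˡ η))))
    ... | no e∉S | _ = ≤-trans (0≤η e) (≤-reflexive (sym (trans
        (+-congʳ (weight-outside f P S (p∩q⊆p S C) e (λ e∈S → contradiction e∈S e∉S))) (+-identityˡ η))))

    load : Fin n → Fin k → Carrier
    load d j = sum (restrict (elem (lookup (es d) j)) w′)

    g : Fin n → Carrier
    g d = η + sum (load d)

    restrict-nonNegative : ∀ T i → 0# ≤ restrict T w′ i
    restrict-nonNegative T i with lookup T i
    ... | true  = 0≤w′ i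
    ... | false = ≤-refl

    0≤g : ∀ d → 0# ≤ g d
    0≤g d = +-nonNegative (0≤η d)
      (sum-nonNegative (λ j → sum-nonNegative (restrict-nonNegative (elem (lookup (es d) j)))))

    -- The elements of `A` lie outside `C`, so `P` survives their removal and the weights measured
    -- from `P` bound the loss.
    remove-≤ : ∀ d → f S ≤ f (S ─ elems (es d)) + sum (load d)
    remove-≤ d = begin
      f S                                             ≤⟨ weight-bound f sub P (S ─ A) S P⊆S─A (p─q⊆p S A) ⟩
      f (S ─ A) + sum (restrict (S ─ (S ─ A)) w)      ≤⟨ +-monoʳ-≤ _ (sum-mono-≤ (restrict-≤ w≤w′ 0≤w′ S─S─A⊆A)) ⟩
      f (S ─ A) + sum (restrict A w′)                 ≤⟨ +-monoʳ-≤ _ (sum-restrict-elems 0≤w′ (es d)) ⟩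
      f (S ─ A) + sum (load d)                        ∎
      where
      A = elems (es d)
      w≤w′ : ∀ e → w e ≤ w′ e
      w≤w′ e = x≤x+y (0≤η e)
      P⊆S─A : P ⊆ S ─ A
      P⊆S─A x∈P with x∈p∩q⁻ S C x∈P
      ... | x∈S , x∈C = x∈p∧x∉q⇒x∈p─q x∈S λ x∈A →
        let j , eq = x∈elems⁻ (es d) x∈A in avoids j eq x∈C
      S─S─A⊆A : S ─ (S ─ A) ⊆ A
      S─S─A⊆A {x} x∈ with x∈p─q⁻ S (S ─ A) x∈ | x ∈? A
      ... | _         , _     | yes x∈A = x∈A
      ... | x∈S , x∉S─A       | no  x∉A = contradiction (x∈p∧x∉q⇒x∈p─q x∈S x∉A) x∉S─A

    -- Submodularity for `S` and the result of the exchange transfers the bound on the exchange to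
    -- the pure addition of `d`.
    add-≤ : ∀ d → d ∈ C → d ∉ S → f (S ∪ ⁅ d ⁆) ≤ f S + g d
    add-≤ d d∈C d∉S = +-cancelʳ-≤ (f (S ─ A)) (begin
      f (S ∪ ⁅ d ⁆) + f (S ─ A)           ≤⟨ submodular-≡ sub S ((S ─ A) ∪ ⁅ d ⁆) union intersection ⟩
      f S + f ((S ─ A) ∪ ⁅ d ⁆)           ≤⟨ +-monoʳ-≤ _ (exchange-≤ d d∈C d∉S) ⟩
      f S + (1# + δ) * f S                ≈⟨ +-congˡ expand ⟩
      f S + (f S + η)                     ≤⟨ +-monoʳ-≤ _ (+-monoˡ-≤ _ (remove-≤ d)) ⟩
      f S + (f (S ─ A) + sum (load d) + η) ≈⟨ solve 4 (λ x y z t → x :+ (y :+ z :+ t) := x :+ (t :+ z) :+ y) refl _ _ _ _ ⟩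
      f S + g d + f (S ─ A)               ∎)
      where
      A = elems (es d)
      union : S ∪ ((S ─ A) ∪ ⁅ d ⁆) ≡ S ∪ ⁅ d ⁆
      union = ≡.trans (≡.sym (∪-assoc S (S ─ A) ⁅ d ⁆)) (≡.cong (_∪ ⁅ d ⁆)
        (≡.trans (∪-comm S (S ─ A)) (p⊆q⇒p∪q≡q (p─q⊆p S A))))
      intersection : S ∩ ((S ─ A) ∪ ⁅ d ⁆) ≡ S ─ A
      intersection = ⊆-antisym ⊆₁ (λ x∈ → x∈p∩q⁺ (p─q⊆p S A x∈ , p⊆p∪q ⁅ d ⁆ x∈))
        where
        ⊆₁ : S ∩ ((S ─ A) ∪ ⁅ d ⁆) ⊆ S ─ A
        ⊆₁ x∈ with x∈p∩q⁻ S _ x∈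
        ... | x∈S , x∈∪ with x∈p∪q⁻ (S ─ A) ⁅ d ⁆ x∈∪
        ... | inj₁ x∈S─A = x∈S─A
        ... | inj₂ x∈⁅d⁆ = contradiction (≡.subst (_∈ S) (x∈⁅y⁆⇒x≡y d x∈⁅d⁆) x∈S) d∉S

    sum-g : sum g ≤ fromℕ n * η + κ * sum w′
    sum-g = begin
      sum g                                 ≈⟨ ∑-distrib-+ (λ _ → η) (λ d → sum (load d)) ⟩
      ∑[ d < n ] η + ∑[ d < n ] sum (load d) ≈⟨ +-cong (sum-const n η) (∑-comm load) ⟩
      fromℕ n * η + ∑[ j < k ] ∑[ d < n ] load d j ≤⟨ +-monoʳ-≤ _ (sum-mono-≤ (λ j →
                                                        sum-restrict-injective 0≤w′ (λ d → lookup (es d) j) (injective j))) ⟩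
      fromℕ n * η + ∑[ j < k ] sum w′       ≈⟨ +-congˡ (sum-const k (sum w′)) ⟩
      fromℕ n * η + κ * sum w′              ∎

-- Exchange maps of matroids

select : {P : Pred (Fin n) 0ℓ} → Decidable P → Subset n
select P? = tabulate (does ∘ P?)

∈-select⁺ : {P : Pred (Fin n) 0ℓ} (P? : Decidable P) → ∀ {x} → P x → x ∈ select P?
∈-select⁺ P? {x} px = lookup⇒[]= x _ (≡.trans (lookup∘tabulate (does ∘ P?) x) (dec-true (P? x) px))

∈-select⁻ : {P : Pred (Fin n) 0ℓ} (P? : Decidable P) → ∀ {x} → x ∈ select P? → P x
∈-select⁻ P? {x} x∈ with P? x | ≡.trans (≡.sym (lookup∘tabulate (does ∘ P?) x)) ([]=⇒lookup x∈)
... | yes px | _ = px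
... | no  _  | ()

∣p∪⁅x⁆∣≤1+∣p∣ : ∀ (p : Subset n) x → ∣ p ∪ ⁅ x ⁆ ∣ ℕ.≤ suc ∣ p ∣
∣p∪⁅x⁆∣≤1+∣p∣ (true  ∷ p) zero    = ℕ.≤-trans (s≤s (ℕ.≤-reflexive (≡.cong ∣_∣ (∪-identityʳ p)))) (ℕ.n≤1+n _)
∣p∪⁅x⁆∣≤1+∣p∣ (false ∷ p) zero    = s≤s (ℕ.≤-reflexive (≡.cong ∣_∣ (∪-identityʳ p)))
∣p∪⁅x⁆∣≤1+∣p∣ (true  ∷ p) (suc x) = s≤s (∣p∪⁅x⁆∣≤1+∣p∣ p x)
∣p∪⁅x⁆∣≤1+∣p∣ (false ∷ p) (suc x) = ∣p∪⁅x⁆∣≤1+∣p∣ p x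

p⊆q∧∣q∣≤∣p∣⇒q⊆p : ∀ {p q : Subset n} → p ⊆ q → ∣ q ∣ ℕ.≤ ∣ p ∣ → q ⊆ p
p⊆q∧∣q∣≤∣p∣⇒q⊆p {p = p} p⊆q ∣q∣≤∣p∣ {x} x∈q with x ∈? p
... | yes x∈p = x∈p
... | no  x∉p = contradiction (p⊂q⇒∣p∣<∣q∣ (p⊆q , x , x∈q , x∉p)) (ℕ.≤⇒≯ ∣q∣≤∣p∣)

p∪⁅x⁆⊆q : ∀ {p q : Subset n} {x} → p ⊆ q → x ∈ q → p ∪ ⁅ x ⁆ ⊆ q
p∪⁅x⁆⊆q {p = p} {q} {x} p⊆q x∈q =
  [ p⊆q , (λ y∈ → ≡.subst (_∈ q) (≡.sym (x∈⁅y⁆⇒x≡y x y∈)) x∈q) ]′ ∘ x∈p∪q⁻ p ⁅ x ⁆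

x∈p∪⁅x⁆ : ∀ (p : Subset n) x → x ∈ p ∪ ⁅ x ⁆
x∈p∪⁅x⁆ p x = q⊆p∪q p ⁅ x ⁆ (x∈⁅x⁆ x)

x∉p-x : ∀ (p : Subset n) x → x ∉ p - x
x∉p-x p x x∈ = proj₂ (x∈p─q⁻ p ⁅ x ⁆ x∈) (x∈⁅x⁆ x)

module MatroidProperties {n : ℕ} (M : Matroid n) where
  open Matroid M

  -- Repeated augmentation from `T`. The number `m` in `go` bounds the augmentations still possible.
  extend : ∀ S T → Indep S → Indep T →
           ∃ λ E → S ⊆ E × E ⊆ S ∪ T × Indep E × ∣ T ∣ ℕ.≤ ∣ E ∣
  extend S T S∈I T∈I = go ∣ T ∣ S (λ x∈S → x∈S) (p⊆p∪q T) S∈I (ℕ.m≤m+n ∣ T ∣ ∣ S ∣)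
    where
    go : ∀ m E → S ⊆ E → E ⊆ S ∪ T → Indep E → ∣ T ∣ ℕ.≤ m ℕ.+ ∣ E ∣ →
         ∃ λ E → S ⊆ E × E ⊆ S ∪ T × Indep E × ∣ T ∣ ℕ.≤ ∣ E ∣
    go zero    E S⊆E E⊆ E∈I ∣T∣≤ = E , S⊆E , E⊆ , E∈I , ∣T∣≤
    go (suc m) E S⊆E E⊆ E∈I ∣T∣≤ with ∣ T ∣ ℕ.≤? ∣ E ∣
    ... | yes ∣T∣≤∣E∣ = E , S⊆E , E⊆ , E∈I , ∣T∣≤∣E∣
    ... | no  ∣T∣≰∣E∣ with augment E∈I T∈I (ℕ.≰⇒> ∣T∣≰∣E∣)
    ... | x , x∈T , x∉E , E+x∈I =
      go m (E ∪ ⁅ x ⁆) (p⊆p∪q ⁅ x ⁆ ∘ S⊆E) (p∪⁅x⁆⊆q E⊆ (q⊆p∪q S T x∈T)) E+x∈I (begin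
        ∣ T ∣                ≤⟨ ∣T∣≤ ⟩
        suc m ℕ.+ ∣ E ∣      ≡⟨ ℕ.+-suc m ∣ E ∣ ⟨
        m ℕ.+ suc ∣ E ∣      ≤⟨ ℕ.+-monoʳ-≤ m (p⊂q⇒∣p∣<∣q∣ (p⊆p∪q ⁅ x ⁆ , x , x∈p∪⁅x⁆ E x , x∉E)) ⟩
        m ℕ.+ ∣ E ∪ ⁅ x ⁆ ∣  ∎)
      where open ℕ.≤-Reasoning

  -- Symmetric exchange is usually stated for bases; here the sizes are arbitrary, and the
  -- dependence of `I ∪ ⁅ b ⁆` supplies the circuit through `b`. The exchange in `I` is the one that
  -- is wanted, while the one in `J` keeps the second set independent when the step is iterated.
  symmetric-exchange : ∀ {I J b} → Indep I → Indep J → b ∈ J → b ∉ I → ¬ Indep (I ∪ ⁅ b ⁆) →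
                       ∃ λ a → a ∈ I × a ∉ J × Indep ((I - a) ∪ ⁅ b ⁆) × Indep ((J - b) ∪ ⁅ a ⁆)
  symmetric-exchange {I} {J} {b} I∈I J∈I b∈J b∉I I+b∉I = conclude
    where
    Exchangeable : Pred (Fin n) 0ℓ
    Exchangeable a = a ∈ I × Indep ((I - a) ∪ ⁅ b ⁆)

    exchangeable? : Decidable Exchangeable
    exchangeable? a with a ∈? I | indep? ((I - a) ∪ ⁅ b ⁆)
    ... | yes p | yes q = yes (p , q)
    ... | yes _ | no ¬q = no (¬q ∘ proj₂)
    ... | no ¬p | _     = no (¬p ∘ proj₁)

    -- D ∪ ⁅ b ⁆ is the fundamental circuit of b in I.
    D : Subset n
    D = select exchangeable?

    D⊆I : D ⊆ I
    D⊆I = proj₁ ∘ ∈-select⁻ exchangeable?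

    -- Otherwise it extends to an independent `E` inside I + b with at least as many elements as
    -- `I`. Such an `E` misses some `a` of `I`, and by counting it is all of I - a + b. So `a` is
    -- exchangeable and belongs to `D`, which `E` contains.
    D+b∉I : ¬ Indep (D ∪ ⁅ b ⁆)
    D+b∉I D+b∈I with extend (D ∪ ⁅ b ⁆) I D+b∈I I∈I
    ... | E , D+b⊆E , E⊆ , E∈I , ∣I∣≤∣E∣ with nonempty? (I ─ E)
    ... | no  I─E-empty = I+b∉I (hereditary (p∪⁅x⁆⊆q I⊆E (D+b⊆E (x∈p∪⁅x⁆ D b))) E∈I)
      where
      I⊆E : I ⊆ E
      I⊆E {x} x∈I with x ∈? E
      ... | yes x∈E = x∈E
      ... | no  x∉E = contradiction (x , x∈p∧x∉q⇒x∈p─q x∈I x∉E) I─E-empty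
    ... | yes (a , a∈I─E) = a∉E (D+b⊆E (p⊆p∪q ⁅ b ⁆ (∈-select⁺ exchangeable? (a∈I , I-a+b∈I))))
      where
      a∈I = proj₁ (x∈p─q⁻ I E a∈I─E)
      a∉E = proj₂ (x∈p─q⁻ I E a∈I─E)

      E⊆I+b : E ⊆ I ∪ ⁅ b ⁆
      E⊆I+b x∈E with x∈p∪q⁻ (D ∪ ⁅ b ⁆) I (E⊆ x∈E)
      ... | inj₂ x∈I = p⊆p∪q ⁅ b ⁆ x∈I
      ... | inj₁ x∈D+b = p∪⁅x⁆⊆q (p⊆p∪q ⁅ b ⁆ ∘ D⊆I) (x∈p∪⁅x⁆ I b) x∈D+b

      E⊆I-a+b : E ⊆ (I - a) ∪ ⁅ b ⁆
      E⊆I-a+b x∈E with x∈p∪q⁻ I ⁅ b ⁆ (E⊆I+b x∈E)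
      ... | inj₁ x∈I = p⊆p∪q ⁅ b ⁆ (x∈p∧x≢y⇒x∈p-y x∈I λ x≡a → a∉E (≡.subst (_∈ E) x≡a x∈E))
      ... | inj₂ x∈b = q⊆p∪q (I - a) ⁅ b ⁆ x∈b

      I-a+b∈I : Indep ((I - a) ∪ ⁅ b ⁆)
      I-a+b∈I = hereditary (p⊆q∧∣q∣≤∣p∣⇒q⊆p E⊆I-a+b (begin
        ∣ (I - a) ∪ ⁅ b ⁆ ∣  ≤⟨ ∣p∪⁅x⁆∣≤1+∣p∣ (I - a) b ⟩
        suc ∣ I - a ∣        ≤⟨ x∈p⇒∣p-x∣<∣p∣ a∈I ⟩
        ∣ I ∣                ≤⟨ ∣I∣≤∣E∣ ⟩
        ∣ E ∣                ∎)) E∈I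
        where open ℕ.≤-Reasoning

    -- Extend `D` by elements of `J` to an independent `E` of at least the size of `J`. It misses
    -- `b`, as it contains `D`, and it is larger than J - b; so it augments J - b by an element that
    -- cannot come from `J` and therefore lies in `D`.
    conclude : ∃ λ a → a ∈ I × a ∉ J × Indep ((I - a) ∪ ⁅ b ⁆) × Indep ((J - b) ∪ ⁅ a ⁆)
    conclude with extend D J (hereditary D⊆I I∈I) J∈I
    ... | E , D⊆E , E⊆D∪J , E∈I , ∣J∣≤∣E∣
      with augment (hereditary (p─q⊆p J ⁅ b ⁆) J∈I) E∈I (ℕ.<-≤-trans (x∈p⇒∣p-x∣<∣p∣ b∈J) ∣J∣≤∣E∣)
    ... | a , a∈E , a∉J-b , J-b+a∈I =
      a , proj₁ (∈-select⁻ exchangeable? a∈D) , a∉J , proj₂ (∈-select⁻ exchangeable? a∈D) , J-b+a∈I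
      where
      b∉E : b ∉ E
      b∉E b∈E = D+b∉I (hereditary (p∪⁅x⁆⊆q D⊆E b∈E) E∈I)
      a∉J : a ∉ J
      a∉J a∈J = a∉J-b (x∈p∧x≢y⇒x∈p-y a∈J λ a≡b → b∉E (≡.subst (_∈ E) a≡b a∈E))
      a∈D : a ∈ D
      a∈D with x∈p∪q⁻ D J (E⊆D∪J a∈E)
      ... | inj₁ a∈D = a∈D
      ... | inj₂ a∈J = contradiction a∈J a∉J

  -- The value `nothing` plays the role of φ. The conditions on targets are imposed for all `b`, not
  -- only for those in `J ─ I`, so that sums over the whole ground set need no side condition.
  record ExchangeMap (I J : Subset n) : Set where
    field
      target    : Fin n → Maybe (Fin n)
      feasible  : ∀ {b} → b ∈ J → b ∉ I → Indep ((I ─ elem (target b)) ∪ ⁅ b ⁆)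
      target-∈  : ∀ {a} b → target b ≡ just a → a ∈ I × a ∉ J
      injective : ∀ {a b b′} → target b ≡ just a → target b′ ≡ just a → b ≡ b′

  exchange-step : ∀ {I J b} → Indep I → Indep J → b ∈ J → b ∉ I →
                  ∃ λ m → Indep ((I ─ elem m) ∪ ⁅ b ⁆) × Indep ((J - b) ∪ elem m) ×
                          (∀ {a} → m ≡ just a → a ∈ I × a ∉ J)
  exchange-step {I} {J} {b} I∈I J∈I b∈J b∉I with indep? (I ∪ ⁅ b ⁆)
  ... | yes I+b∈I = nothing , ≡.subst (λ S → Indep (S ∪ ⁅ b ⁆)) (≡.sym (p─⊥≡p I)) I+b∈I ,
                    ≡.subst Indep (≡.sym (∪-identityʳ (J - b))) (hereditary (p─q⊆p J ⁅ b ⁆) J∈I) , λ ()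
  ... | no  I+b∉I with symmetric-exchange I∈I J∈I b∈J b∉I I+b∉I
  ... | a , a∈I , a∉J , I-a+b∈I , J-b+a∈I = just a , I-a+b∈I , J-b+a∈I , λ { ≡.refl → a∈I , a∉J }

  -- One `b` of `J ─ I` is matched with an `e`, and the induction continues with `J′`, which has `e`
  -- in place of `b`. Later targets lie outside `J′` and so differ from `e`: injectivity comes
  -- without a matching theorem. The measure decreases since `e` lies in `I`, if it is an element at
  -- all.
  exchangeMap : ∀ I J → Indep I → Indep J → ExchangeMap I J
  exchangeMap I J I∈I J∈I = go ∣ J ─ I ∣ J J∈I ℕ.≤-refl
    where
    go : ∀ m J → Indep J → ∣ J ─ I ∣ ℕ.≤ m → ExchangeMap I J
    go m J J∈I ∣J─I∣≤m with nonempty? (J ─ I)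
    ... | no  J─I-empty = record
      { target    = λ _ → nothing
      ; feasible  = λ b∈J b∉I → contradiction (_ , x∈p∧x∉q⇒x∈p─q b∈J b∉I) J─I-empty
      ; target-∈  = λ _ ()
      ; injective = λ ()
      }
    go zero J J∈I ∣J─I∣≤0 | yes (b , b∈J─I) =
      contradiction (ℕ.<-≤-trans (x∈p⇒∣p-x∣<∣p∣ b∈J─I) ∣J─I∣≤0) λ ()
    go (suc m) J J∈I ∣J─I∣≤1+m | yes (b , b∈J─I) with x∈p─q⁻ J I b∈J─I
    ... | b∈J , b∉I with exchange-step I∈I J∈I b∈J b∉I
    ... | e , I-e+b∈I , J′∈I , e-∈ = record
      { target    = target
      ; feasible  = feasible
      ; target-∈  = target-∈
      ; injective = λ {a} {x} {x′} → injective x x′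
      }
      where
      J′ = (J - b) ∪ elem e

      J′─I⊂J─I : J′ ─ I ⊂ J ─ I
      J′─I⊂J─I = J′─I⊆J─I , b , b∈J─I , λ b∈J′─I → b∉J′ (p─q⊆p J′ I b∈J′─I)
        where
        b∉J′ : b ∉ J′
        b∉J′ b∈J′ with x∈p∪q⁻ (J - b) (elem e) b∈J′
        ... | inj₁ b∈J-b = x∉p-x J b b∈J-b
        ... | inj₂ b∈e   = b∉I (proj₁ (e-∈ (x∈elem⁻ e b∈e)))
        J′─I⊆J─I : J′ ─ I ⊆ J ─ I
        J′─I⊆J─I x∈ with x∈p─q⁻ J′ I x∈
        ... | x∈J′ , x∉I with x∈p∪q⁻ (J - b) (elem e) x∈J′
        ... | inj₁ x∈J-b = x∈p∧x∉q⇒x∈p─q (p─q⊆p J ⁅ b ⁆ x∈J-b) x∉I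
        ... | inj₂ x∈e   = contradiction (proj₁ (e-∈ (x∈elem⁻ e x∈e))) x∉I

      module π = ExchangeMap (go m J′ J′∈I (ℕ.≤-pred (ℕ.≤-trans (p⊂q⇒∣p∣<∣q∣ J′─I⊂J─I) ∣J─I∣≤1+m)))

      target : Fin n → Maybe (Fin n)
      target x with x Fin.≟ b
      ... | yes _ = e
      ... | no  _ = π.target x

      feasible : ∀ {x} → x ∈ J → x ∉ I → Indep ((I ─ elem (target x)) ∪ ⁅ x ⁆)
      feasible {x} x∈J x∉I with x Fin.≟ b
      ... | yes ≡.refl = I-e+b∈I
      ... | no  x≢b    = π.feasible (p⊆p∪q (elem e) (x∈p∧x≢y⇒x∈p-y x∈J x≢b)) x∉I

      ∉J′⇒∉J : ∀ {a} → a ∈ I → a ∉ J′ → a ∉ J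
      ∉J′⇒∉J a∈I a∉J′ a∈J = a∉J′ (p⊆p∪q (elem e) (x∈p∧x≢y⇒x∈p-y a∈J λ { ≡.refl → b∉I a∈I }))

      target-∈ : ∀ {a} x → target x ≡ just a → a ∈ I × a ∉ J
      target-∈ x eq with x Fin.≟ b
      ... | yes _ = e-∈ eq
      ... | no  _ with π.target-∈ x eq
      ... | a∈I , a∉J′ = a∈I , ∉J′⇒∉J a∈I a∉J′

      ≢e : ∀ {a} x → e ≡ just a → π.target x ≢ just a
      ≢e {a} x ≡.refl eq = proj₂ (π.target-∈ x eq) (q⊆p∪q (J - b) ⁅ a ⁆ (x∈⁅x⁆ a))

      injective : ∀ {a} x x′ → target x ≡ just a → target x′ ≡ just a → x ≡ x′
      injective x x′ eq eq′ with x Fin.≟ b | x′ Fin.≟ b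
      ... | yes x≡b | yes x′≡b = ≡.trans x≡b (≡.sym x′≡b)
      ... | yes _   | no  _    = contradiction eq′ (≢e x′ eq)
      ... | no  _   | yes _    = contradiction eq (≢e x eq′)
      ... | no  _   | no  _    = π.injective eq eq′

-- The algorithm

length-cartesianProductWith : ∀ {a b c} {A : Set a} {B : Set b} {C : Set c} (g : A → B → C) xs ys →
                              length (cartesianProductWith g xs ys) ≡ length xs ℕ.* length ys
length-cartesianProductWith g []       ys = ≡.refl
length-cartesianProductWith g (x ∷ xs) ys = ≡.trans (length-++ (List.map (g x) ys))
  (≡.cong₂ ℕ._+_ (length-map (g x) ys) (length-cartesianProductWith g xs ys))

length-tuples : ∀ {a} {A : Set a} m (xs : List A) → length (tuples m xs) ≡ length xs ℕ.^ m
length-tuples zero    xs = ≡.refl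
length-tuples (suc m) xs = ≡.trans (length-cartesianProductWith _∷_ xs (tuples m xs))
  (≡.cong (length xs ℕ.*_) (length-tuples m xs))

∈-tuples⁺ : ∀ {a} {A : Set a} {m} {xs : List A} (v : Vec A m) → (∀ x → x ∈ˡ xs) → v ∈ˡ tuples m xs
∈-tuples⁺ []      all∈ = here ≡.refl
∈-tuples⁺ (x ∷ v) all∈ = ∈-cartesianProductWith⁺ _∷_ (all∈ x) (∈-tuples⁺ v all∈)

length-allFin : ∀ n → length (List.allFin n) ≡ n
length-allFin n = length-tabulate id

length-allMoves : ∀ n k → length (allMoves n k) ≡ n ℕ.+ n ℕ.* suc n ℕ.^ k
length-allMoves n k = ≡.trans (length-++ (List.map delete (List.allFin n)))
  (≡.cong₂ ℕ._+_ (≡.trans (length-map delete (List.allFin n)) (length-allFin n))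
    (≡.trans (length-cartesianProductWith exchange (List.allFin n) _)
      (≡.cong₂ ℕ._*_ (length-allFin n) (≡.trans (length-tuples k _)
        (≡.cong (λ m → suc m ℕ.^ k) (≡.trans (length-map just (List.allFin n)) (length-allFin n)))))))

∈-allMoves : ∀ {n k} (m : Move n k) → m ∈ˡ allMoves n k
∈-allMoves (delete e)      = ∈-++⁺ˡ (∈-map⁺ delete (∈-allFin e))
∈-allMoves {n} (exchange d es) = ∈-++⁺ʳ (List.map delete (List.allFin n))
  (∈-cartesianProductWith⁺ exchange (∈-allFin d) (∈-tuples⁺ es all∈))
  where
  all∈ : ∀ e → e ∈ˡ nothing ∷ List.map just (List.allFin n)
  all∈ nothing  = here ≡.refl
  all∈ (just e) = there (∈-map⁺ just (∈-allFin e))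

module LocalSearch {c ℓ₁ ℓ₂} (F : OrderedField c ℓ₁ ℓ₂) {n k : ℕ} (M : Fin k → Matroid n)
                   (f : Subset n → OrderedField.Carrier F) (ε : OrderedField.Carrier F)
                   (choices : Choices n k) where
  open OrderedField F hiding (zero; _-_; refl; trans; sym)
  open OrderedFieldProperties F using (≮⇒≥; ≰⇒≥; <⇒≱; ≤-refl; ≤-trans)
  open Algorithm F M f ε choices hiding (elem)
  open Choices choices
  open Matroid using (Indep; indep?)
  open Times n k

  β : Carrier
  β = 1# + ε * fromℕ (n ℕ.^ 4) ⁻¹

  -- The strict inequality of an exchange is kept in two halves: the weak one gives the same growth
  -- as a deletion, and the negated converse refutes exchanges that gain nothing.
  data Step (X S : Subset n) : Subset n → Set ℓ₂ where
    deletion : ∀ {e} → e ∈ S → β * f S ≤ f (S - e) → Step X S (S - e)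
    exchange : ∀ {d} es → d ∈ X → let S′ = (S ─ elems {k = k} es) ∪ ⁅ d ⁆ in
               Common M S′ → β * f S ≤ f S′ → ¬ f S′ ≤ β * f S → Step X S S′

  Exchangeable : (X S : Subset n) → Fin n → Vec (Maybe (Fin n)) k → Set
  Exchangeable X S d es = d ∈ X × d ∉ S × AllVec (AllMaybe (_∈ S)) es ×
    (∀ j → Indep (M j) ((S ─ elem (lookup es j)) ∪ ⁅ d ⁆))

  Unavailable : (X S : Subset n) → Move n k → Set ℓ₂
  Unavailable X S (delete e)      = e ∈ S → f (S - e) ≤ β * f S
  Unavailable X S (exchange d es) = Exchangeable X S d es → f ((S ─ elems es) ∪ ⁅ d ⁆) ≤ β * f S

  LocalOptimum : (X S : Subset n) → Set ℓ₂
  LocalOptimum X S = ∀ m → Unavailable X S m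

  allIndependent-reflects : ∀ T js → Reflects (All (λ j → Indep (M j) (T j)) js) (result (allIndependent T js))
  allIndependent-reflects T []       = ofʸ []
  allIndependent-reflects T (j ∷ js) with indep? (M j) (T j)
  ... | no ¬p = ofⁿ λ { (p ∷ _) → ¬p p }
  ... | yes p with result (allIndependent T js) | allIndependent-reflects T js
  ... | _ | ofʸ ps  = ofʸ (p ∷ ps)
  ... | _ | ofⁿ ¬ps = ofⁿ λ { (_ ∷ ps) → ¬ps ps }

  allIndependent-time : ∀ T js → time (allIndependent T js) ℕ.≤ length js ℕ.* suc n
  allIndependent-time T []       = z≤n
  allIndependent-time T (j ∷ js) with indep? (M j) (T j)
  ... | no  _ = ℕ.≤-trans (ℕ.≤-reflexive (ℕ.+-comm n 1)) (ℕ.m≤m+n (suc n) _)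
  ... | yes _ = begin
    n ℕ.+ suc (time (allIndependent T js))    ≡⟨ ℕ.+-suc n _ ⟩
    suc n ℕ.+ time (allIndependent T js)      ≤⟨ ℕ.+-monoʳ-≤ (suc n) (allIndependent-time T js) ⟩
    suc n ℕ.+ length js ℕ.* suc n             ∎
    where open ℕ.≤-Reasoning

  allIndependent-allFin-time : ∀ T → time (allIndependent T (List.allFin k)) ℕ.≤ k ℕ.* suc n
  allIndependent-allFin-time T = ≡.subst (λ m → time (allIndependent T (List.allFin k)) ℕ.≤ m ℕ.* suc n)
    (length-allFin k) (allIndependent-time T (List.allFin k))

  -- Defined by cases on the answer, so that abstracting over the result of `attempt` refines its
  -- specification at the same time.
  AttemptOutcome : (X S : Subset n) → Move n k → Maybe (Subset n) → Set ℓ₂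
  AttemptOutcome X S m nothing   = Unavailable X S m
  AttemptOutcome X S m (just S′) = Step X S S′

  attempt-outcome : ∀ X S m → AttemptOutcome X S m (result (attempt X S m))
  attempt-outcome X S (delete e) with e ∈? S
  ... | no  e∉S = λ e∈S → contradiction e∈S e∉S
  ... | yes e∈S with β * f S ≤? f (S - e)
  ... | no  ≰ = λ _ → ≰⇒≥ ≰
  ... | yes βS≤ = deletion e∈S βS≤
  attempt-outcome X S (exchange d es) with d ∈? X
  ... | no  d∉X = λ where (d∈X , _) → contradiction d∈X d∉X
  ... | yes d∈X with d ∈? S
  ... | yes d∈S = λ where (_ , d∉S , _) → contradiction d∈S d∉S
  ... | no  d∉S with allVec? (allMaybe? (_∈? S)) es
  ... | no  ¬p = λ where (_ , _ , p , _) → contradiction p ¬p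
  ... | yes _ with result (allIndependent (λ i → (S ─ elem (lookup es i)) ∪ ⁅ d ⁆) (List.allFin k))
                 | allIndependent-reflects (λ i → (S ─ elem (lookup es i)) ∪ ⁅ d ⁆) (List.allFin k)
  ... | _ | ofⁿ ¬p = λ where (_ , _ , _ , p) → contradiction (All.universal p _) ¬p
  ... | _ | ofʸ p with (β * f S) <? f ((S ─ elems es) ∪ ⁅ d ⁆)
  ... | no  ≮ = λ _ → ≮⇒≥ ≮
  ... | yes βS< = exchange es d∈X common (proj₁ βS<) (<⇒≱ βS<)
    where
    -- The tests remove one entry per matroid, the exchange removes all of them; the new set is thus
    -- contained in each tested set.
    common : Common M ((S ─ elems es) ∪ ⁅ d ⁆)
    common j = Matroid.hereditary (M j) S′⊆ (All.lookup p (∈-allFin j))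
      where
      S′⊆ : (S ─ elems es) ∪ ⁅ d ⁆ ⊆ (S ─ elem (lookup es j)) ∪ ⁅ d ⁆
      S′⊆ x∈ with x∈p∪q⁻ (S ─ elems es) ⁅ d ⁆ x∈
      ... | inj₂ x∈d = q⊆p∪q (S ─ elem (lookup es j)) ⁅ d ⁆ x∈d
      ... | inj₁ x∈S─es with x∈p─q⁻ S (elems es) x∈S─es
      ... | x∈S , x∉es = p⊆p∪q ⁅ d ⁆ (x∈p∧x∉q⇒x∈p─q x∈S (x∉es ∘ elem⊆elems es j))

  attempt-time : ∀ X S m → time (attempt X S m) ℕ.≤ deleteTime ℕ.+ exchangeTime
  attempt-time X S (delete e) = ℕ.≤-trans ≤deleteTime (ℕ.m≤m+n deleteTime exchangeTime)
    where
    ≤deleteTime : time (attempt X S (delete e)) ℕ.≤ deleteTime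
    ≤deleteTime with e ∈? S
    ... | no  _ = ℕ.+-monoʳ-≤ 1 z≤n
    ... | yes _ with β * f S ≤? f (S - e)
    ... | no  _ = ℕ.≤-refl
    ... | yes _ = ℕ.≤-refl
  attempt-time X S (exchange d es) = ℕ.≤-trans ≤exchangeTime (ℕ.m≤n+m exchangeTime deleteTime)
    where
    T : Fin k → Subset n
    T i = (S ─ elem (lookup es i)) ∪ ⁅ d ⁆
    ≤exchangeTime : time (attempt X S (exchange d es)) ℕ.≤ exchangeTime
    ≤exchangeTime with d ∈? X
    ... | no  _ = ℕ.+-monoʳ-≤ 1 z≤n
    ... | yes _ with d ∈? S
    ... | yes _ = ℕ.+-monoʳ-≤ 2 z≤n
    ... | no  _ with allVec? (allMaybe? (_∈? S)) es
    ... | no  _ = ℕ.+-monoʳ-≤ 2 (ℕ.+-monoʳ-≤ k z≤n)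
    ... | yes _ with result (allIndependent T (List.allFin k))
    ... | false = ℕ.+-monoʳ-≤ 2 (ℕ.+-monoʳ-≤ k (ℕ.+-mono-≤ (allIndependent-allFin-time T) z≤n))
    ... | true with (β * f S) <? f ((S ─ elems es) ∪ ⁅ d ⁆)
    ... | no  _ = ℕ.+-monoʳ-≤ 2 (ℕ.+-monoʳ-≤ k (ℕ.+-monoˡ-≤ _ (allIndependent-allFin-time T)))
    ... | yes _ = ℕ.+-monoʳ-≤ 2 (ℕ.+-monoʳ-≤ k (ℕ.+-monoˡ-≤ _ (allIndependent-allFin-time T)))

  SearchOutcome : (X S : Subset n) → List (Move n k) → Maybe (Subset n) → Set ℓ₂
  SearchOutcome X S ms nothing   = All (Unavailable X S) ms
  SearchOutcome X S ms (just S′) = Step X S S′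

  search-outcome : ∀ X S ms → SearchOutcome X S ms (result (search X S ms))
  search-outcome X S []       = []
  search-outcome X S (m ∷ ms) with result (attempt X S m) | attempt-outcome X S m
  ... | just S′ | S→S′ = S→S′
  ... | nothing | ¬m with result (search X S ms) | search-outcome X S ms
  ... | just S′ | S→S′ = S→S′
  ... | nothing | ¬ms  = ¬m ∷ ¬ms

  search-time : ∀ X S ms → time (search X S ms) ℕ.≤ length ms ℕ.* moveTime
  search-time X S []       = z≤n
  search-time X S (m ∷ ms) with result (attempt X S m)
  ... | just S′ = ℕ.≤-trans (ℕ.+-monoʳ-≤ (suc k) (ℕ.≤-trans (ℕ.≤-reflexive (ℕ.+-identityʳ _)) (attempt-time X S m)))
                            (ℕ.m≤m+n moveTime _)
  ... | nothing = begin
    suc k ℕ.+ (time (attempt X S m) ℕ.+ time (search X S ms))  ≡⟨ ℕ.+-assoc (suc k) _ _ ⟨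
    suc k ℕ.+ time (attempt X S m) ℕ.+ time (search X S ms)    ≤⟨ ℕ.+-mono-≤ (ℕ.+-monoʳ-≤ (suc k) (attempt-time X S m))
                                                                              (search-time X S ms) ⟩
    moveTime ℕ.+ length ms ℕ.* moveTime                        ∎
    where open ℕ.≤-Reasoning

  ImproveOutcome : (X S : Subset n) → Maybe (Subset n) → Set ℓ₂
  ImproveOutcome X S nothing   = LocalOptimum X S
  ImproveOutcome X S (just S′) = Step X S S′

  improve-outcome : ∀ r X S → ImproveOutcome X S (result (improve r X S))
  improve-outcome r X S with result (improve r X S) | search-outcome X S (proj₁ (moves r S))
  ... | just S′ | S→S′ = S→S′
  -- The examined list is a permutation of all moves, so its exhaustion excludes every move,
  -- whatever the order.
  ... | nothing | ¬ms  = λ m → All.lookup ¬ms (∈-resp-↭ (↭-sym (proj₂ (moves r S))) (∈-allMoves m))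

  improve-time : ∀ r X S → time (improve r X S) ℕ.≤ searchTime
  improve-time r X S = ≡.subst (λ m → time (improve r X S) ℕ.≤ m ℕ.* moveTime)
    (≡.trans (↭-length (proj₂ (moves r S))) (length-allMoves n k)) (search-time X S (proj₁ (moves r S)))

  better-∈ : ∀ S Ts → result (better S Ts) ∈ˡ S ∷ Ts
  better-∈ S []       = here ≡.refl
  better-∈ S (T ∷ Ts) with f S <? f T
  ... | yes _ = there (better-∈ T Ts)
  ... | no  _ with better-∈ S Ts
  ... | here eq = here eq
  ... | there p = there (there p)

  better-≥ : ∀ S Ts → All (λ T → f T ≤ f (result (better S Ts))) (S ∷ Ts)
  better-≥ S []       = ≤-refl ∷ []
  better-≥ S (T ∷ Ts) with f S <? f T
  ... | yes S<T with better-≥ T Ts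
  ... | T≤ ∷ Ts≤ = ≤-trans (proj₁ S<T) T≤ ∷ T≤ ∷ Ts≤
  better-≥ S (T ∷ Ts) | no S≮T with better-≥ S Ts
  ... | S≤ ∷ Ts≤ = S≤ ∷ ≤-trans (≮⇒≥ S≮T) S≤ ∷ Ts≤

  better-time : ∀ S Ts → time (better S Ts) ℕ.≤ length Ts ℕ.* 3
  better-time S []       = z≤n
  better-time S (T ∷ Ts) with f S <? f T
  ... | yes _ = ℕ.+-monoʳ-≤ 3 (better-time T Ts)
  ... | no  _ = ℕ.+-monoʳ-≤ 3 (better-time S Ts)

  best-∈ : ∀ Ss → result (best Ss) ∈ˡ Ss ⊎ Ss ≡ [] × result (best Ss) ≡ ⊥
  best-∈ []       = inj₂ (≡.refl , ≡.refl)
  best-∈ (S ∷ Ss) = inj₁ (better-∈ S Ss)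

  best-≥ : ∀ Ss → All (λ T → f T ≤ f (result (best Ss))) Ss
  best-≥ []       = []
  best-≥ (S ∷ Ss) = better-≥ S Ss

  best-time : ∀ Ss → time (best Ss) ℕ.≤ length Ss ℕ.* 3
  best-time []       = z≤n
  best-time (S ∷ Ss) = ℕ.≤-trans (better-time S Ss) (ℕ.m≤n+m _ 3)

  Feasible : Subset n → Subset n → Set
  Feasible X S = Common M S × S ⊆ X

  feasibleSingletons-feasible : ∀ X vs → All (Feasible X) (result (feasibleSingletons X vs))
  feasibleSingletons-feasible X []       = []
  feasibleSingletons-feasible X (v ∷ vs) with v ∈? X
  ... | no  _ = feasibleSingletons-feasible X vs
  ... | yes v∈X with result (allIndependent (λ _ → ⁅ v ⁆) (List.allFin k))
                   | allIndependent-reflects (λ _ → ⁅ v ⁆) (List.allFin k)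
  ... | _ | ofⁿ _ = feasibleSingletons-feasible X vs
  ... | _ | ofʸ p = ((λ j → All.lookup p (∈-allFin j)) , λ x∈v → ≡.subst (_∈ X) (≡.sym (x∈⁅y⁆⇒x≡y v x∈v)) v∈X)
                    ∷ feasibleSingletons-feasible X vs

  ∈-feasibleSingletons : ∀ X {v} vs → v ∈ˡ vs → v ∈ X → Common M ⁅ v ⁆ →
                         ⁅ v ⁆ ∈ˡ result (feasibleSingletons X vs)
  ∈-feasibleSingletons X {v} (u ∷ vs) v∈ v∈X common with u ∈? X
  ∈-feasibleSingletons X (u ∷ vs) (here ≡.refl) v∈X common | no u∉X = contradiction v∈X u∉X
  ∈-feasibleSingletons X (u ∷ vs) (there v∈) v∈X common | no u∉X = ∈-feasibleSingletons X vs v∈ v∈X common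
  ... | yes _ with result (allIndependent (λ _ → ⁅ u ⁆) (List.allFin k))
                 | allIndependent-reflects (λ _ → ⁅ u ⁆) (List.allFin k)
  ∈-feasibleSingletons X (u ∷ vs) (here ≡.refl) v∈X common | yes _ | _ | ofⁿ ¬p = contradiction (All.universal common _) ¬p
  ∈-feasibleSingletons X (u ∷ vs) (there v∈) v∈X common | yes _ | _ | ofⁿ _ = ∈-feasibleSingletons X vs v∈ v∈X common
  ∈-feasibleSingletons X (u ∷ vs) (here ≡.refl) v∈X common | yes _ | _ | ofʸ _ = here ≡.refl
  ∈-feasibleSingletons X (u ∷ vs) (there v∈) v∈X common | yes _ | _ | ofʸ _ = there (∈-feasibleSingletons X vs v∈ v∈X common)

  length-feasibleSingletons : ∀ X vs → length (result (feasibleSingletons X vs)) ℕ.≤ length vs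
  length-feasibleSingletons X []       = z≤n
  length-feasibleSingletons X (v ∷ vs) with v ∈? X
  ... | no  _ = ℕ.m≤n⇒m≤1+n (length-feasibleSingletons X vs)
  ... | yes _ with result (allIndependent (λ _ → ⁅ v ⁆) (List.allFin k))
  ... | false = ℕ.m≤n⇒m≤1+n (length-feasibleSingletons X vs)
  ... | true  = s≤s (length-feasibleSingletons X vs)

  feasibleSingletons-time : ∀ X vs →
    time (feasibleSingletons X vs) ℕ.≤ length vs ℕ.* (1 ℕ.+ (k ℕ.* suc n ℕ.+ n))
  feasibleSingletons-time X []       = z≤n
  feasibleSingletons-time X (v ∷ vs) = begin
    time (feasibleSingletons X (v ∷ vs))                      ≤⟨ ≤vs+v ⟩
    time (feasibleSingletons X vs) ℕ.+ perElement             ≤⟨ ℕ.+-monoˡ-≤ perElement (feasibleSingletons-time X vs) ⟩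
    length vs ℕ.* perElement ℕ.+ perElement                   ≡⟨ ℕ.+-comm (length vs ℕ.* perElement) perElement ⟩
    perElement ℕ.+ length vs ℕ.* perElement                   ∎
    where
    open ℕ.≤-Reasoning
    perElement = 1 ℕ.+ (k ℕ.* suc n ℕ.+ n)
    ≤vs+v : time (feasibleSingletons X (v ∷ vs)) ℕ.≤ time (feasibleSingletons X vs) ℕ.+ perElement
    ≤vs+v with v ∈? X
    ... | no  _ = ℕ.+-monoʳ-≤ (time (feasibleSingletons X vs)) (ℕ.+-monoʳ-≤ 1 z≤n)
    ... | yes _ with result (allIndependent (λ _ → ⁅ v ⁆) (List.allFin k))
    ... | false = ℕ.+-monoʳ-≤ (time (feasibleSingletons X vs)) (ℕ.+-monoʳ-≤ 1 (ℕ.+-mono-≤ (allIndependent-allFin-time _) z≤n))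
    ... | true  = ℕ.+-monoʳ-≤ (time (feasibleSingletons X vs)) (ℕ.+-monoʳ-≤ 1 (ℕ.+-monoˡ-≤ n (allIndependent-allFin-time _)))

  start-feasible : ∀ r X → Feasible X (result (start r X))
  start-feasible r X with best-∈ (result (feasibleSingletons X (proj₁ (elements r))))
  ... | inj₁ S∈       = All.lookup (feasibleSingletons-feasible X (proj₁ (elements r))) S∈
  ... | inj₂ (_ , S≡⊥) = ≡.subst (Feasible X) (≡.sym S≡⊥) ((λ j → Matroid.∅-indep (M j)) , λ x∈⊥ → contradiction x∈⊥ ∉⊥)

  -- The purpose of starting at the best singleton: the initial value bounds all feasible singletons
  -- and thereby, up to a factor 1 + n, all non-empty feasible sets.
  start-≥ : ∀ r X {v} → v ∈ X → Common M ⁅ v ⁆ → f ⁅ v ⁆ ≤ f (result (start r X))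
  start-≥ r X {v} v∈X common = All.lookup (best-≥ (result (feasibleSingletons X (proj₁ (elements r))))) (∈-feasibleSingletons X _
    (∈-resp-↭ (↭-sym (proj₂ (elements r))) (∈-allFin v)) v∈X common)

  start-time : ∀ r X → time (start r X) ℕ.≤ startTime
  start-time r X = ℕ.+-mono-≤
    (ℕ.≤-trans (feasibleSingletons-time X vs) (ℕ.*-monoˡ-≤ _ (ℕ.≤-reflexive length-vs)))
    (ℕ.≤-trans (best-time (result (feasibleSingletons X vs))) (ℕ.*-monoˡ-≤ 3
      (ℕ.≤-trans (length-feasibleSingletons X vs) (ℕ.≤-reflexive length-vs))))
    where
    vs = proj₁ (elements r)
    length-vs : length vs ≡ n
    length-vs = ≡.trans (↭-length (proj₂ (elements r))) (length-allFin n)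

-- Termination and approximation ratio

Fin⇒1≤n : ∀ {n} → Fin n → 1 ℕ.≤ n
Fin⇒1≤n {suc n} _ = s≤s z≤n

1≤n⇒1≤n^m : ∀ {n} m → 1 ℕ.≤ n → 1 ℕ.≤ n ℕ.^ m
1≤n⇒1≤n^m {suc n} m _ = ℕ.m^n>0 (suc n) m

module Analysis {c ℓ₁ ℓ₂} (F : OrderedField c ℓ₁ ℓ₂) {n k : ℕ} (M : Fin k → Matroid n)
                (f : Subset n → OrderedField.Carrier F) (ε : OrderedField.Carrier F)
                (choices : Choices n k) (f-nonNegative : NonNegative F f) (f-submodular : Submodular F f)
                (0<ε : OrderedField._<_ F (OrderedField.0# F) ε) where
  open OrderedField F hiding (zero; _-_)
  open OrderedFieldProperties F
  open SubmodularProperties F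
  open MatroidProperties using (ExchangeMap; exchangeMap)
  open Algorithm F M f ε choices hiding (elem; AlgorithmA)
  open LocalSearch F M f ε choices
  open Matroid using (Indep)
  open Times n k
  open ≤-Reasoning hiding (start; stop)

  -- For n = 0 this is ε times the unspecified inverse of 0, possibly negative.
  δ : Carrier
  δ = ε * fromℕ (n ℕ.^ 4) ⁻¹

  0<n⁴ : 1 ℕ.≤ n → 0# < fromℕ (n ℕ.^ 4)
  0<n⁴ 1≤n = 0<fromℕ (n ℕ.^ 4) (1≤n⇒1≤n^m 4 1≤n)

  0≤δ : 1 ℕ.≤ n → 0# ≤ δ
  0≤δ 1≤n = *-nonNegative (proj₁ 0<ε) (0<x⇒0≤x⁻¹ (0<n⁴ 1≤n))

  n⁴*δ≈ε : 1 ℕ.≤ n → fromℕ (n ℕ.^ 4) * δ ≈ ε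
  n⁴*δ≈ε 1≤n = begin-equality
    N * (ε * N ⁻¹)  ≈⟨ solve 3 (λ N ε i → N :* (ε :* i) := ε :* (N :* i)) refl N ε (N ⁻¹) ⟩
    ε * (N * N ⁻¹)  ≈⟨ *-congˡ (*-inverseʳ (0<x⇒x≉0 (0<n⁴ 1≤n))) ⟩
    ε * 1#          ≈⟨ *-identityʳ ε ⟩
    ε               ∎
    where N = fromℕ (n ℕ.^ 4)

  n*δ≤ε : fromℕ n * δ ≤ ε
  n*δ≤ε with 1 ℕ.≤? n
  -- For n = 0 the left side vanishes, whatever the inverse of 0 is.
  ... | no  1≰n = begin
    fromℕ n * δ  ≡⟨ ≡.cong (λ m → fromℕ m * δ) (ℕ.n<1⇒n≡0 (ℕ.≰⇒> 1≰n)) ⟩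
    0# * δ       ≈⟨ zeroˡ δ ⟩
    0#           ≤⟨ proj₁ 0<ε ⟩
    ε            ∎
  ... | yes 1≤n = begin
    fromℕ n * δ          ≤⟨ *-monoˡ-≤ (0≤δ 1≤n) (fromℕ-mono-≤ n (n ℕ.^ 4) n≤n⁴) ⟩
    fromℕ (n ℕ.^ 4) * δ  ≈⟨ n⁴*δ≈ε 1≤n ⟩
    ε                    ∎
    where
    n≤n⁴ : n ℕ.≤ n ℕ.^ 4
    n≤n⁴ = ℕ.≤-trans (ℕ.≤-reflexive (≡.sym (ℕ.*-identityʳ n))) (ℕ.*-monoʳ-≤ n (1≤n⇒1≤n^m 3 1≤n))

  fS≤β*fS : 1 ℕ.≤ n → ∀ S → f S ≤ β * f S
  fS≤β*fS 1≤n S = begin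
    f S            ≤⟨ x≤x+y (*-nonNegative (0≤δ 1≤n) (f-nonNegative S)) ⟩
    f S + δ * f S  ≈⟨ solve 2 (λ x d → x :+ d :* x := (con 1 :+ d) :* x) refl (f S) δ ⟩
    β * f S        ∎

  -- The exchange vector of `d` collects its targets under the exchange maps of the individual
  -- matroids. The accumulated slack `fromℕ n * δ` is at most `ε`, which yields the factor `1# + ε`.
  local-optimum-≤ : ∀ {X S} → LocalOptimum X S → Feasible X S → ∀ C → Feasible X C →
                    f (S ∪ C) + fromℕ k * f (S ∩ C) ≤ (1# + ε) * (fromℕ k + 1#) * f S
  local-optimum-≤ {X} {S} optimal (S∈I , S⊆X) C (C∈I , C⊆X) = begin
    f (S ∪ C) + fromℕ k * f (S ∩ C)                  ≤⟨ local-optimum-bound f f-submodular δ S C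
                                                          (λ i → *-nonNegative (0≤δ (Fin⇒1≤n i)) (f-nonNegative S))
                                                          es injective avoids (λ e → optimal (delete e))
                                                          (λ d d∈C d∉S → optimal (exchange d (es d)) (exchangeable d d∈C d∉S)) ⟩
    (fromℕ k + 1#) * (f S + fromℕ n * (δ * f S))     ≈⟨ *-congˡ (+-congˡ (*-assoc (fromℕ n) δ (f S))) ⟨
    (fromℕ k + 1#) * (f S + fromℕ n * δ * f S)       ≤⟨ *-monoʳ-≤ (+-nonNegative (0≤fromℕ k) 0≤1)
                                                          (+-monoʳ-≤ (f S) (*-monoˡ-≤ (f-nonNegative S) n*δ≤ε)) ⟩
    (fromℕ k + 1#) * (f S + ε * f S)                 ≈⟨ solve 3 (λ κ ε x → κ :* (x :+ ε :* x) := (con 1 :+ ε) :* κ :* x)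
                                                          refl (fromℕ k + 1#) ε (f S) ⟩
    (1# + ε) * (fromℕ k + 1#) * f S                  ∎
    where
    module π j = ExchangeMap (exchangeMap (M j) S C (S∈I j) (C∈I j))

    es : Fin n → Vec (Maybe (Fin n)) k
    es d = tabulate (λ j → π.target j d)

    lookup-es : ∀ d j → lookup (es d) j ≡ π.target j d
    lookup-es d j = lookup∘tabulate (λ j → π.target j d) j

    injective : ∀ {d d′ e} j → lookup (es d) j ≡ just e → lookup (es d′) j ≡ just e → d ≡ d′
    injective {d} {d′} j p q =
      π.injective j (≡.trans (≡.sym (lookup-es d j)) p) (≡.trans (≡.sym (lookup-es d′ j)) q)

    avoids : ∀ {d e} j → lookup (es d) j ≡ just e → e ∉ C
    avoids {d} j p = proj₂ (π.target-∈ j d (≡.trans (≡.sym (lookup-es d j)) p))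

    exchangeable : ∀ d → d ∈ C → d ∉ S → Exchangeable X S d (es d)
    exchangeable d d∈C d∉S = C⊆X d∈C , d∉S , AllVec.tabulate⁺ es∈S , λ j →
      ≡.subst (λ e → Indep (M j) ((S ─ elem e) ∪ ⁅ d ⁆)) (≡.sym (lookup-es d j)) (π.feasible j d∈C d∉S)
      where
      es∈S : ∀ j → AllMaybe (_∈ S) (π.target j d)
      es∈S j with π.target j d in eq
      ... | just e  = just (proj₁ (π.target-∈ j d eq))
      ... | nothing = nothing

  step-feasible : ∀ {X S S′} → Feasible X S → Step X S S′ → Feasible X S′
  step-feasible {S = S} (S∈I , S⊆X) (deletion {e} e∈S _) =
    (λ j → Matroid.hereditary (M j) (p─q⊆p S ⁅ e ⁆) (S∈I j)) , S⊆X ∘ p─q⊆p S ⁅ e ⁆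
  step-feasible {S = S} (S∈I , S⊆X) (exchange es d∈X S′∈I _ _) =
    S′∈I , p∪⁅x⁆⊆q (S⊆X ∘ p─q⊆p S (elems es)) d∈X

  step-1≤n : ∀ {X S S′} → Step X S S′ → 1 ℕ.≤ n
  step-1≤n (deletion {e} _ _)         = Fin⇒1≤n e
  step-1≤n (exchange {d} _ _ _ _ _) = Fin⇒1≤n d

  step-≥ : ∀ {X S S′} → Step X S S′ → β * f S ≤ f S′
  step-≥ (deletion _ βS≤S′)         = βS≤S′
  step-≥ (exchange _ _ _ βS≤S′ _) = βS≤S′

  -- Non-negativity makes `f` subadditive, so `T` is built up from one of its singletons. The empty
  -- set is excluded because its value is not controlled by the singletons.
  feasible-≤ : ∀ {X L} → (∀ {v} → v ∈ X → Common M ⁅ v ⁆ → f ⁅ v ⁆ ≤ L) → 0# ≤ L →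
               ∀ {T x} → Feasible X T → x ∈ T → f T ≤ (1# + fromℕ n) * L
  feasible-≤ {X} {L} singleton-≤ 0≤L {T} {x} (T∈I , T⊆X) x∈T = begin
    f T                        ≡⟨ ≡.cong f (p⊆q⇒p∪q≡q ⁅x⁆⊆T) ⟨
    f (⁅ x ⁆ ∪ T)              ≤⟨ union-bound f f-submodular ⁅ x ⁆ T (λ _ → L) (λ _ → 0≤L) add-≤ ⟩
    f ⁅ x ⁆ + ∑[ i < n ] L     ≤⟨ +-mono-≤ (∈-≤ x∈T) (≤-reflexive (sum-const n L)) ⟩
    L + fromℕ n * L            ≈⟨ solve 2 (λ l m → l :+ m :* l := (con 1 :+ m) :* l) refl L (fromℕ n) ⟩
    (1# + fromℕ n) * L         ∎
    where
    ⁅y⁆⊆T : ∀ {y} → y ∈ T → ⁅ y ⁆ ⊆ T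
    ⁅y⁆⊆T {y} y∈T z∈⁅y⁆ = ≡.subst (_∈ T) (≡.sym (x∈⁅y⁆⇒x≡y y z∈⁅y⁆)) y∈T
    ⁅x⁆⊆T : ⁅ x ⁆ ⊆ T
    ⁅x⁆⊆T = ⁅y⁆⊆T x∈T
    ∈-≤ : ∀ {y} → y ∈ T → f ⁅ y ⁆ ≤ L
    ∈-≤ y∈T = singleton-≤ (T⊆X y∈T) (λ j → Matroid.hereditary (M j) (⁅y⁆⊆T y∈T) (T∈I j))
    add-≤ : ∀ i → i ∈ T → i ∉ ⁅ x ⁆ → f (⁅ x ⁆ ∪ ⁅ i ⁆) ≤ f ⁅ x ⁆ + L
    add-≤ i i∈T _ = begin
      f (⁅ x ⁆ ∪ ⁅ i ⁆)                         ≤⟨ x≤x+y (f-nonNegative _) ⟩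
      f (⁅ x ⁆ ∪ ⁅ i ⁆) + f (⁅ x ⁆ ∩ ⁅ i ⁆)     ≤⟨ f-submodular ⁅ x ⁆ ⁅ i ⁆ ⟩
      f ⁅ x ⁆ + f ⁅ i ⁆                         ≤⟨ +-monoʳ-≤ _ (∈-≤ i∈T) ⟩
      f ⁅ x ⁆ + L                               ∎

  -- After j steps the value has grown from L to at least (1 + j δ) L, while by
  -- submodularity it is at most (1 + n) L as long as S is non-empty; so j ≤ n⁵ / ε.
  iterations-≤ : ∀ {m} → ε ⁻¹ ≤ fromℕ m → 1 ℕ.≤ n → ∀ {L} → 0# < L →
                 ∀ j → (1# + fromℕ j * δ) * L ≤ (1# + fromℕ n) * L → j ℕ.≤ maxIterations m
  iterations-≤ {m} ε⁻¹≤m 1≤n {L} 0<L j growth-≤ = fromℕ-cancel-≤ j (maxIterations m) (*-cancelˡ-≤ 0<ε (begin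
    ε * J                  ≈⟨ *-congʳ (n⁴*δ≈ε 1≤n) ⟨
    N * δ * J              ≈⟨ solve 3 (λ N d J → N :* d :* J := N :* (J :* d)) refl N δ J ⟩
    N * (J * δ)            ≤⟨ *-monoʳ-≤ (0≤fromℕ (n ℕ.^ 4)) jδ≤n ⟩
    N * fromℕ n            ≈⟨ *-identityˡ _ ⟨
    1# * (N * fromℕ n)     ≤⟨ *-monoˡ-≤ (*-nonNegative (0≤fromℕ (n ℕ.^ 4)) (0≤fromℕ n)) 1≤εm ⟩
    ε * fromℕ m * (N * fromℕ n)  ≈⟨ solve 4 (λ e m N n → e :* m :* (N :* n) := e :* (n :* N :* m)) refl ε (fromℕ m) N (fromℕ n) ⟩
    ε * (fromℕ n * N * fromℕ m)  ≈⟨ *-congˡ (*-congʳ (×1-homo-* n (n ℕ.^ 4))) ⟨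
    ε * (fromℕ (n ℕ.* n ℕ.^ 4) * fromℕ m)  ≈⟨ *-congˡ (×1-homo-* (n ℕ.* n ℕ.^ 4) m) ⟨
    ε * fromℕ (maxIterations m)  ∎))
    where
    J = fromℕ j
    N = fromℕ (n ℕ.^ 4)
    1≤εm : 1# ≤ ε * fromℕ m
    1≤εm = begin
      1#           ≈⟨ *-inverseʳ (0<x⇒x≉0 0<ε) ⟨
      ε * ε ⁻¹     ≤⟨ *-monoʳ-≤ (proj₁ 0<ε) ε⁻¹≤m ⟩
      ε * fromℕ m  ∎
    jδ≤n : J * δ ≤ fromℕ n
    jδ≤n = +-cancelʳ-≤ 1# (*-cancelˡ-≤ 0<L (begin
      L * (J * δ + 1#)        ≈⟨ solve 2 (λ l x → l :* (x :+ con 1) := (con 1 :+ x) :* l) refl L (J * δ) ⟩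
      (1# + J * δ) * L        ≤⟨ growth-≤ ⟩
      (1# + fromℕ n) * L      ≈⟨ solve 2 (λ l x → (con 1 :+ x) :* l := l :* (x :+ con 1)) refl L (fromℕ n) ⟩
      L * (fromℕ n + 1#)      ∎))

  empty-≡ : ∀ {S : Subset n} (A : Subset n) d → ¬ (∃ λ x → x ∈ S) → (S ─ A) ∪ ⁅ d ⁆ ≡ ⁅ d ⁆
  empty-≡ {S} A d S-empty = ≡.trans (≡.cong (_∪ ⁅ d ⁆) (Empty-unique λ where (x , x∈) → S-empty (x , p─q⊆p S A x∈)))
                                    (∪-identityˡ ⁅ d ⁆)

  -- Termination of the local search

  module Termination {m : ℕ} (ε⁻¹≤m : ε ⁻¹ ≤ fromℕ m) (r : ℕ) (X : Subset n) where

    S₀ : Subset n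
    S₀ = result (start r X)

    L : Carrier
    L = f S₀

    0≤L : 0# ≤ L
    0≤L = f-nonNegative S₀

    -- At most i further steps follow. In the first case every non-empty feasible
    -- set has value 0, so that only deletions are possible.
    data Fuel (i : ℕ) (S : Subset n) : Set (ℓ₁ ⊔ ℓ₂) where
      shrinking : L ≈ 0# → ∣ S ∣ ℕ.≤ i → Fuel i S
      growing   : 0# < L → ∀ j → (1# + fromℕ j * δ) * L ≤ f S →
                  maxIterations m ℕ.< j ℕ.+ i → Fuel i S

    -- An exchange out of the empty set leads to a feasible singleton, which is no better than the
    -- start. So the upper bound for non-empty sets applies whenever a step is possible.
    empty-stuck : ∀ {S S′} → ¬ (∃ λ x → x ∈ S) → L ≤ f S → ¬ Step X S S′
    empty-stuck S-empty L≤fS (deletion e∈S _) = S-empty (_ , e∈S)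
    empty-stuck {S} S-empty L≤fS S→S′@(exchange {d} es d∈X S′∈I _ S′≰βS) = S′≰βS (begin
      f ((S ─ elems es) ∪ ⁅ d ⁆)  ≡⟨ ≡.cong f S′≡d ⟩
      f ⁅ d ⁆                     ≤⟨ start-≥ r X d∈X (≡.subst (Common M) S′≡d S′∈I) ⟩
      L                           ≤⟨ L≤fS ⟩
      f S                         ≤⟨ fS≤β*fS (step-1≤n S→S′) S ⟩
      β * f S                     ∎)
      where S′≡d = empty-≡ (elems es) d S-empty

    -- A step is impossible once the fuel is used up. The equation for `i` is what makes `run`
    -- structurally recursive.
    step-fuel : ∀ {i S S′} → Feasible X S → L ≤ f S → Fuel i S → Step X S S′ →
                ∃ λ i′ → i ≡ suc i′ × Fuel i′ S′
    step-fuel {i} {S} {S′} S-feasible L≤fS fuel S→S′ with nonempty? S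
    ... | no  S-empty = contradiction S→S′ (empty-stuck S-empty L≤fS)
    ... | yes (x , x∈S) = go fuel S→S′
      where
      1≤n = step-1≤n S→S′
      go : ∀ {i S′} → Fuel i S → Step X S S′ → ∃ λ i′ → i ≡ suc i′ × Fuel i′ S′
      go {zero} (shrinking L≈0 ∣S∣≤0) (deletion e∈S _) =
        contradiction (ℕ.<-≤-trans (x∈p⇒∣p-x∣<∣p∣ e∈S) ∣S∣≤0) λ ()
      go {suc i} (shrinking L≈0 ∣S∣≤i) (deletion e∈S _) =
        i , ≡.refl , shrinking L≈0 (ℕ.≤-pred (ℕ.<-≤-trans (x∈p⇒∣p-x∣<∣p∣ e∈S) ∣S∣≤i))
      go (shrinking L≈0 _) S→S′@(exchange {d} es _ _ _ S′≰βS) = contradiction (begin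
        f ((S ─ elems es) ∪ ⁅ d ⁆)  ≤⟨ feasible-≤ (start-≥ r X) 0≤L (step-feasible S-feasible S→S′) (x∈p∪⁅x⁆ _ d) ⟩
        (1# + fromℕ n) * L          ≈⟨ trans (*-congˡ L≈0) (zeroʳ _) ⟩
        0#                          ≤⟨ f-nonNegative S ⟩
        f S                         ≤⟨ fS≤β*fS 1≤n S ⟩
        β * f S                     ∎) S′≰βS
      go {i} (growing 0<L j growth bound<) S→S′ with i
      ... | zero   = contradiction (ℕ.<-≤-trans bound< (ℕ.≤-reflexive (ℕ.+-identityʳ j)))
        (ℕ.≤⇒≯ (iterations-≤ ε⁻¹≤m 1≤n 0<L j (≤-trans growth (feasible-≤ (start-≥ r X) 0≤L S-feasible x∈S))))
      ... | suc i′ = i′ , ≡.refl , growing 0<L (suc j) growth′ (ℕ.≤-trans bound< (ℕ.≤-reflexive (ℕ.+-suc j i′)))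
        where
        -- The induction step of Bernoulli's inequality: (1 + δ)(1 + jδ) exceeds 1 + (j + 1)δ by
        -- jδ². The linear lower bound avoids logarithms.
        growth′ : (1# + fromℕ (suc j) * δ) * L ≤ _
        growth′ = begin
          (1# + (1# + fromℕ j) * δ) * L  ≤⟨ x≤x+y (*-nonNegative (*-nonNegative (*-nonNegative (0≤δ 1≤n) (0≤fromℕ j)) (0≤δ 1≤n)) 0≤L) ⟩
          (1# + (1# + fromℕ j) * δ) * L + δ * fromℕ j * δ * L
                                         ≈⟨ solve 3 (λ d j l → (con 1 :+ (con 1 :+ j) :* d) :* l :+ d :* j :* d :* l :=
                                              (con 1 :+ d) :* ((con 1 :+ j :* d) :* l)) refl δ (fromℕ j) L ⟩
          β * ((1# + fromℕ j * δ) * L)   ≤⟨ *-monoʳ-≤ (+-nonNegative 0≤1 (0≤δ 1≤n)) growth ⟩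
          β * f S                        ≤⟨ step-≥ S→S′ ⟩
          _                              ∎

    -- Besides the `i` possible steps, `suc i` counts the last search, which fails. The invariant
    -- `L ≤ f S` is needed to exclude steps from the empty set.
    run : ∀ i S → Feasible X S → L ≤ f S → Fuel i S →
          ∃[ S′ ] ∃[ u ] (While (improve r X) S S′ u × u ℕ.≤ suc i ℕ.* searchTime ×
                          Feasible X S′ × LocalOptimum X S′)
    run i S S-feasible L≤fS fuel
      with result (improve r X S) in eq | improve-outcome r X S
    ... | nothing | optimal =
      S , time (improve r X S) , stop (≡.cong (_after time (improve r X S)) eq) ,
      ℕ.≤-trans (improve-time r X S) (ℕ.m≤m+n searchTime _) , S-feasible , optimal
    ... | just S′ | S→S′ with step-fuel S-feasible L≤fS fuel S→S′
    ... | i′ , ≡.refl , fuel′ with run i′ S′ (step-feasible S-feasible S→S′)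
                                (≤-trans L≤fS (≤-trans (fS≤β*fS (step-1≤n S→S′) S) (step-≥ S→S′))) fuel′
    ... | S″ , u , S′⇝S″ , u≤ , S″-feasible , optimal =
      S″ , _ , step (≡.cong (_after time (improve r X S)) eq) S′⇝S″ , ℕ.+-mono-≤ (improve-time r X S) u≤ , S″-feasible , optimal

    fuel₀ : Fuel (suc (maxIterations m) ℕ.+ n) S₀
    fuel₀ with L ≟ 0#
    ... | yes L≈0 = shrinking L≈0 (ℕ.≤-trans (∣p∣≤n S₀) (ℕ.m≤n+m n _))
    ... | no  L≉0 = growing (0≤L , L≉0 ∘ sym) 0 (≤-reflexive (begin-equality
      (1# + 0# * δ) * L  ≈⟨ solve 2 (λ d l → (con 1 :+ con 0 :* d) :* l := l) refl δ L ⟩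
      L                  ∎)) (ℕ.m≤m+n _ n)

  procedureB : ∀ {m} → ε ⁻¹ ≤ fromℕ m → ∀ r X →
               ∃[ S ] ∃[ t ] (ProcedureB r X S t × t ℕ.≤ procedureTime m × Feasible X S × LocalOptimum X S)
  procedureB ε⁻¹≤m r X with Termination.run ε⁻¹≤m r X _ _ (start-feasible r X) ≤-refl (Termination.fuel₀ ε⁻¹≤m r X)
  ... | S , u , S₀⇝S , u≤ , S-feasible , optimal =
    S , _ , (u , S₀⇝S , ≡.refl) , ℕ.+-mono-≤ (start-time r X) u≤ , S-feasible , optimal

  -- Combining the rounds

  data LocalOptima : ℕ → Subset n → List (Subset n) → Set ℓ₂ where
    []  : ∀ {X} → LocalOptima 0 X []
    _∷_ : ∀ {r X S Ss} → Feasible X S × LocalOptimum X S → LocalOptima r (X ─ S) Ss →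
          LocalOptima (suc r) X (S ∷ Ss)

  rounds : ∀ {m} → ε ⁻¹ ≤ fromℕ m → ∀ r X →
           ∃[ Ss ] ∃[ t ] (Rounds r X Ss t × t ℕ.≤ r ℕ.* (procedureTime m ℕ.+ n) × LocalOptima r X Ss)
  rounds ε⁻¹≤m zero    X = [] , 0 , [] , z≤n , []
  rounds {m} ε⁻¹≤m (suc r) X with procedureB ε⁻¹≤m r X
  ... | S , t , X⇝S , t≤ , S-optimal with rounds ε⁻¹≤m r (X ─ S)
  ... | Ss , u , X─S⇝Ss , u≤ , Ss-optimal =
    S ∷ Ss , _ , X⇝S ∷ X─S⇝Ss , ≤time , S-optimal ∷ Ss-optimal
    where
    ≤time : t ℕ.+ (n ℕ.+ u) ℕ.≤ suc r ℕ.* (procedureTime m ℕ.+ n)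
    ≤time = ℕ.≤-trans (ℕ.≤-reflexive (≡.sym (ℕ.+-assoc t n u))) (ℕ.+-mono-≤ (ℕ.+-monoˡ-≤ n t≤) u≤)

  length-LocalOptima : ∀ {r X Ss} → LocalOptima r X Ss → length Ss ≡ r
  length-LocalOptima []       = ≡.refl
  length-LocalOptima (_ ∷ Ss) = ≡.cong suc (length-LocalOptima Ss)

  LocalOptima-common : ∀ {r X Ss} → LocalOptima r X Ss → All (Common M) Ss
  LocalOptima-common []                             = []
  LocalOptima-common (((S∈I , _) , _) ∷ optima) = S∈I ∷ LocalOptima-common optima

  valueSum : List (Subset n) → Carrier
  valueSum []       = 0#
  valueSum (S ∷ Ss) = f S + valueSum Ss

  valueSum-≤ : ∀ {v Ss} → All (λ S → f S ≤ v) Ss → valueSum Ss ≤ fromℕ (length Ss) * v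
  valueSum-≤ {v} []                       = ≤-reflexive (sym (zeroˡ v))
  valueSum-≤ {v} {_ ∷ Ss} (S≤v ∷ Ss≤v) = begin
    _                                 ≤⟨ +-mono-≤ S≤v (valueSum-≤ Ss≤v) ⟩
    v + fromℕ (length Ss) * v         ≈⟨ solve 2 (λ v m → v :+ m :* v := (con 1 :+ m) :* v) refl v (fromℕ (length Ss)) ⟩
    (1# + fromℕ (length Ss)) * v      ∎

  κ G : Carrier
  κ = fromℕ k
  G = (1# + ε) * (κ + 1#)

  module Rest {T : Subset n} (T∈I : Common M T) where

    rest-feasible : ∀ X → Feasible X (T ∩ X)
    rest-feasible X = (λ j → Matroid.hereditary (M j) (p∩q⊆p T X) (T∈I j)) , p∩q⊆q T X

    -- Subadditivity, again from non-negativity. It measures what a copy of f(T ∩ X) loses on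
    -- passing to the next round.
    rest-≤ : ∀ X S → f (T ∩ X) ≤ f (T ∩ (X ─ S)) + f (S ∩ (T ∩ X))
    rest-≤ X S = begin
      f (T ∩ X)                                   ≡⟨ ≡.cong f (⊆-antisym ⊆∪ ∪⊆) ⟩
      f (D′ ∪ (S ∩ D))                            ≤⟨ x≤x+y (f-nonNegative _) ⟩
      f (D′ ∪ (S ∩ D)) + f (D′ ∩ (S ∩ D))         ≤⟨ f-submodular D′ (S ∩ D) ⟩
      f D′ + f (S ∩ D)                            ∎
      where
      D  = T ∩ X
      D′ = T ∩ (X ─ S)
      ⊆∪ : D ⊆ D′ ∪ (S ∩ D)
      ⊆∪ {x} x∈D with x∈p∩q⁻ T X x∈D | x ∈? S
      ... | _ , _     | yes x∈S = q⊆p∪q D′ (S ∩ D) (x∈p∩q⁺ (x∈S , x∈D))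
      ... | x∈T , x∈X | no  x∉S = p⊆p∪q (S ∩ D) (x∈p∩q⁺ (x∈T , x∈p∧x∉q⇒x∈p─q x∈X x∉S))
      ∪⊆ : D′ ∪ (S ∩ D) ⊆ D
      ∪⊆ x∈ with x∈p∪q⁻ D′ (S ∩ D) x∈
      ... | inj₂ x∈S∩D = p∩q⊆q S D x∈S∩D
      ... | inj₁ x∈D′ with x∈p∩q⁻ T (X ─ S) x∈D′
      ... | x∈T , x∈X─S = x∈p∩q⁺ (x∈T , p─q⊆p X S x∈X─S)

    -- Inside `X` the sets `U` and `T` agree, and `S` lies in `X`; hence `U` and `S ∪ (T ∩ X)` meet
    -- exactly in `T ∩ X`, and submodularity gives the bound.
    round-≤ : ∀ {X S U} → S ⊆ X → U ∩ X ⊆ T → T ∩ X ⊆ U →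
              f (U ∪ (S ∪ (T ∩ X))) + f (T ∩ X) ≤ f U + f (S ∪ (T ∩ X))
    round-≤ {X} {S} {U} S⊆X U∩X⊆T T∩X⊆U = submodular-≡ f-submodular U (S ∪ D) ≡.refl (⊆-antisym ∩⊆ ⊆∩)
      where
      D = T ∩ X
      ∩⊆ : U ∩ (S ∪ D) ⊆ D
      ∩⊆ x∈ with x∈p∩q⁻ U (S ∪ D) x∈
      ... | x∈U , x∈S∪D with x∈p∪q⁻ S D x∈S∪D
      ... | inj₂ x∈D = x∈D
      ... | inj₁ x∈S = x∈p∩q⁺ (U∩X⊆T (x∈p∩q⁺ (x∈U , S⊆X x∈S)) , S⊆X x∈S)
      ⊆∩ : D ⊆ U ∩ (S ∪ D)
      ⊆∩ x∈D = x∈p∩q⁺ (T∩X⊆U x∈D , q⊆p∪q S D x∈D)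

    -- U is T together with sets chosen in earlier rounds, which are disjoint from X.
    rounds-≤ : ∀ {r X Ss U} → r ℕ.≤ k → LocalOptima r X Ss → U ∩ X ⊆ T → T ∩ X ⊆ U →
               fromℕ r * f (T ∩ X) ≤ f U + G * valueSum Ss
    rounds-≤ {X = X} {U = U} _ [] _ _ = begin
      0# * f (T ∩ X)  ≈⟨ zeroˡ _ ⟩
      0#              ≤⟨ f-nonNegative U ⟩
      f U             ≈⟨ +-identityʳ (f U) ⟨
      f U + 0#        ≈⟨ +-congˡ (zeroʳ G) ⟨
      f U + G * 0#    ∎
    rounds-≤ {suc r} {X} {S ∷ Ss} {U} r<k ((S-feasible@(_ , S⊆X) , optimal) ∷ optima) U∩X⊆T T∩X⊆U = begin
      (1# + ρ) * f D                        ≈⟨ solve 2 (λ r d → (con 1 :+ r) :* d := d :+ r :* d) refl ρ (f D) ⟩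
      f D + ρ * f D                         ≤⟨ +-monoʳ-≤ _ (*-monoʳ-≤ (0≤fromℕ r) (rest-≤ X S)) ⟩
      f D + ρ * (f D′ + f (S ∩ D))          ≈⟨ +-congˡ (distribˡ ρ _ _) ⟩
      -- One copy of `f D` is kept for `round-≤`, the other r go on to the next round. As r ≤ k,
      -- their loss is at most `κ * f (S ∩ D)`, the amount that local optimality pays for.
      f D + (ρ * f D′ + ρ * f (S ∩ D))      ≤⟨ +-monoʳ-≤ _ (+-mono-≤ (rounds-≤ r≤k optima U′∩X′⊆T T∩X′⊆U′)
                                                 (*-monoˡ-≤ (f-nonNegative _) (fromℕ-mono-≤ r k r≤k))) ⟩
      f D + (f U′ + G * V + κ * f (S ∩ D))  ≈⟨ solve 4 (λ d u v s → d :+ (u :+ v :+ s) := u :+ d :+ (s :+ v)) refl _ _ _ _ ⟩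
      f U′ + f D + (κ * f (S ∩ D) + G * V)  ≤⟨ +-monoˡ-≤ _ (round-≤ S⊆X U∩X⊆T T∩X⊆U) ⟩
      f U + f (S ∪ D) + (κ * f (S ∩ D) + G * V)
                                            ≈⟨ solve 4 (λ u c s v → u :+ c :+ (s :+ v) := u :+ (c :+ s :+ v)) refl _ _ _ _ ⟩
      f U + (f (S ∪ D) + κ * f (S ∩ D) + G * V)
                                            ≤⟨ +-monoʳ-≤ _ (+-monoˡ-≤ _ (local-optimum-≤ optimal S-feasible D (rest-feasible X))) ⟩
      f U + (G * f S + G * V)               ≈⟨ +-congˡ (distribˡ G _ _) ⟨
      f U + G * (f S + V)                   ∎
      where
      D  = T ∩ X
      D′ = T ∩ (X ─ S)
      U′ = U ∪ (S ∪ D)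
      V  = valueSum Ss
      ρ  = fromℕ r
      r≤k = ℕ.<⇒≤ r<k
      U′∩X′⊆T : U′ ∩ (X ─ S) ⊆ T
      U′∩X′⊆T x∈ with x∈p∩q⁻ U′ (X ─ S) x∈
      ... | x∈U′ , x∈X─S with x∈p─q⁻ X S x∈X─S | x∈p∪q⁻ U (S ∪ D) x∈U′
      ... | x∈X , _   | inj₁ x∈U = U∩X⊆T (x∈p∩q⁺ (x∈U , x∈X))
      ... | _   , x∉S | inj₂ x∈S∪D with x∈p∪q⁻ S D x∈S∪D
      ... | inj₁ x∈S = contradiction x∈S x∉S
      ... | inj₂ x∈D = p∩q⊆p T X x∈D
      T∩X′⊆U′ : D′ ⊆ U′
      T∩X′⊆U′ x∈D′ with x∈p∩q⁻ T (X ─ S) x∈D′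
      ... | x∈T , x∈X─S = p⊆p∪q (S ∪ D) (T∩X⊆U (x∈p∩q⁺ (x∈T , p─q⊆p X S x∈X─S)))

    -- The first round keeps no copy of f(T): it passes on all k of them and provides the initial
    -- `U`, the union of `S` and `T`. Each of the k remaining rounds then uses up one copy.
    all-rounds-≤ : ∀ {Ss} → LocalOptima (suc k) ⊤ Ss → κ * f T ≤ G * valueSum Ss
    all-rounds-≤ {S ∷ Ss} ((S-feasible , optimal) ∷ optima) = begin
      κ * f T                                   ≡⟨ ≡.cong (λ T → κ * f T) (∩-identityʳ T) ⟨
      κ * f D                                   ≤⟨ *-monoʳ-≤ (0≤fromℕ k) (rest-≤ ⊤ S) ⟩
      κ * (f D′ + f (S ∩ D))                    ≈⟨ distribˡ κ _ _ ⟩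
      κ * f D′ + κ * f (S ∩ D)                  ≤⟨ +-monoˡ-≤ _ (rounds-≤ ℕ.≤-refl optima U∩X⊆T T∩X⊆U) ⟩
      f (S ∪ D) + G * V + κ * f (S ∩ D)         ≈⟨ solve 3 (λ u v s → u :+ v :+ s := u :+ s :+ v) refl _ _ _ ⟩
      f (S ∪ D) + κ * f (S ∩ D) + G * V         ≤⟨ +-monoˡ-≤ _ (local-optimum-≤ optimal S-feasible D (rest-feasible ⊤)) ⟩
      G * f S + G * V                           ≈⟨ distribˡ G _ _ ⟨
      G * (f S + V)                             ∎
      where
      D  = T ∩ ⊤
      D′ = T ∩ (⊤ ─ S)
      V  = valueSum Ss
      U∩X⊆T : (S ∪ D) ∩ (⊤ ─ S) ⊆ T
      U∩X⊆T x∈ with x∈p∩q⁻ (S ∪ D) (⊤ ─ S) x∈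
      ... | x∈U , x∈⊤─S with x∈p∪q⁻ S D x∈U
      ... | inj₁ x∈S = contradiction x∈S (x∈p─q⇒x∉q x∈⊤─S)
      ... | inj₂ x∈D = p∩q⊆p T ⊤ x∈D
      T∩X⊆U : D′ ⊆ S ∪ D
      T∩X⊆U x∈D′ = q⊆p∪q S D (x∈p∩q⁺ (p∩q⊆p T (⊤ ─ S) x∈D′ , ∈⊤))

  ratio : Carrier
  ratio = (1# + ε) * (κ + fromℕ 2 + κ ⁻¹)

  0<ratio : 1 ℕ.≤ k → 0# < ratio
  0<ratio 1≤k = *-positive (<-≤-trans 0<1 (x≤x+y (proj₁ 0<ε)))
    (<-≤-trans (0<fromℕ k 1≤k) (≤-trans (x≤x+y (0≤fromℕ 2)) (x≤x+y (0<x⇒0≤x⁻¹ (0<fromℕ k 1≤k)))))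

  κ*ratio≈G*[1+κ] : 1 ℕ.≤ k → κ * ratio ≈ G * fromℕ (suc k)
  κ*ratio≈G*[1+κ] 1≤k = begin-equality
    κ * ((1# + ε) * (κ + fromℕ 2 + κ ⁻¹))           ≈⟨ solve 3 (λ κ e i →
                                                         κ :* ((con 1 :+ e) :* (κ :+ (con 1 :+ (con 1 :+ con 0)) :+ i)) :=
                                                         (con 1 :+ e) :* (κ :* κ :+ con 2 :* κ :+ κ :* i)) refl κ ε (κ ⁻¹) ⟩
    (1# + ε) * (κ * κ + (1# + 1#) * κ + κ * κ ⁻¹)   ≈⟨ *-congˡ (+-congˡ (*-inverseʳ (0<x⇒x≉0 (0<fromℕ k 1≤k)))) ⟩
    (1# + ε) * (κ * κ + (1# + 1#) * κ + 1#)         ≈⟨ solve 2 (λ κ e →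
                                                         (con 1 :+ e) :* (κ :* κ :+ con 2 :* κ :+ con 1) :=
                                                         (con 1 :+ e) :* (κ :+ con 1) :* (con 1 :+ κ)) refl κ ε ⟩
    G * fromℕ (suc k)                               ∎

  common-≤ : 1 ℕ.≤ k → ∀ {Ss v} → LocalOptima (suc k) ⊤ Ss → All (λ S → f S ≤ v) Ss →
             ∀ {T} → Common M T → f T ≤ ratio * v
  common-≤ 1≤k {Ss} {v} optima Ss≤v {T} T∈I = *-cancelˡ-≤ (0<fromℕ k 1≤k) (begin
    κ * f T                             ≤⟨ Rest.all-rounds-≤ T∈I optima ⟩
    G * valueSum Ss                     ≤⟨ *-monoʳ-≤ 0≤G (valueSum-≤ Ss≤v) ⟩
    G * (fromℕ (length Ss) * v)         ≡⟨ ≡.cong (λ m → G * (fromℕ m * v)) (length-LocalOptima optima) ⟩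
    G * (fromℕ (suc k) * v)             ≈⟨ *-assoc G (fromℕ (suc k)) v ⟨
    G * fromℕ (suc k) * v               ≈⟨ *-congʳ (κ*ratio≈G*[1+κ] 1≤k) ⟨
    κ * ratio * v                       ≈⟨ *-assoc κ ratio v ⟩
    κ * (ratio * v)                     ∎)
    where
    0≤G : 0# ≤ G
    0≤G = *-nonNegative (+-nonNegative 0≤1 (proj₁ 0<ε)) (+-nonNegative (0≤fromℕ k) 0≤1)

  optimum-≤ : 1 ℕ.≤ k → ∀ {Ss v} → LocalOptima (suc k) ⊤ Ss → All (λ S → f S ≤ v) Ss →
              ratio ⁻¹ * optimum F M f ≤ v
  optimum-≤ 1≤k optima Ss≤v = x≤y*z⇒y⁻¹*x≤z (0<ratio 1≤k) (Extrema.max≤v⁺ totalOrder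
    (common-≤ 1≤k optima Ss≤v (λ j → Matroid.∅-indep (M j)))
    (All.map⁺ (All.map (common-≤ 1≤k optima Ss≤v) (All.all-filter (common? M) (tuples n (true ∷ false ∷ []))))))

  algorithmA : ∀ {m} → ε ⁻¹ ≤ fromℕ m → 1 ℕ.≤ k →
               ∃[ S ] ∃[ t ] (AlgorithmA F M f ε choices S t × t ℕ.≤ totalTime m × Common M S ×
                              ratio ⁻¹ * optimum F M f ≤ f S)
  algorithmA ε⁻¹≤m 1≤k with rounds ε⁻¹≤m (suc k) ⊤
  ... | Ss , u , ⊤⇝Ss , u≤ , optima = result (best Ts) , _ , (Ss , u , ⊤⇝Ss , ≡.refl , ≡.refl) ,
    ℕ.+-mono-≤ u≤ (ℕ.≤-trans (best-time Ts) (ℕ.*-monoˡ-≤ 3 (ℕ.≤-reflexive length-Ts))) ,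
    best-common , optimum-≤ 1≤k optima (All-resp-↭ Ts↭Ss (best-≥ Ts))
    where
    Ts = proj₁ (Choices.outputs choices Ss)
    Ts↭Ss = proj₂ (Choices.outputs choices Ss)
    length-Ts : length Ts ≡ suc k
    length-Ts = ≡.trans (↭-length Ts↭Ss) (length-LocalOptima optima)
    best-common : Common M (result (best Ts))
    best-common with best-∈ Ts
    ... | inj₁ S∈         = All.lookup (LocalOptima-common optima) (∈-resp-↭ Ts↭Ss S∈)
    ... | inj₂ (_ , S≡⊥) = ≡.subst (Common M) (≡.sym S≡⊥) (λ j → Matroid.∅-indep (M j))

theorem4 : ∀ {c ℓ₁ ℓ₂} (F : OrderedField c ℓ₁ ℓ₂) → let open OrderedField F in
    ∀ (a b : ℕ) → ∃[ C ]
    (∀ {n k : ℕ} → 1 ℕ.≤ k →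
    (M : Fin k → Matroid n) (f : Subset n → Carrier) →
    NonNegative F f → Submodular F f →
    (ε : Carrier) → 0# < ε → ε ⁻¹ ≤ fromℕ (a ℕ.* n ℕ.^ b) →
    (choices : Choices n k) →
    ∃[ S ] ∃[ t ]
    (AlgorithmA F M f ε choices S t ×
    (2 ℕ.≤ n → t ℕ.≤ n ℕ.^ (C ℕ.* k)) ×
    Common M S ×
    ((1# + ε) * (fromℕ k + fromℕ 2 + fromℕ k ⁻¹)) ⁻¹ * optimum F M f ≤ f S))
theorem4 F a b = proj₁ (totalTimeᵖ a b) , λ 1≤k M f f-nonNegative f-submodular ε 0<ε ε⁻¹≤anᵇ choices →
  let S , t , A⇝S , t≤ , S-common , S-≥ =
        Analysis.algorithmA F M f ε choices f-nonNegative f-submodular 0<ε ε⁻¹≤anᵇ 1≤k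
  in S , t , A⇝S , (λ 2≤n → ℕ.≤-trans t≤ (proj₂ (totalTimeᵖ a b) 2≤n 1≤k)) , S-common , S-≥
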